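{- Let $f(x)\in\mathbb{Q}(x)$ be a rational function of degree $2$. Then: (a) If $f$ has two distinct poles in $\mathbb{P}^1(\mathbb{Q})$, then $f$ satisfies WP. (b) If $f$ has exactly one pole in $\mathbb{P}^1(\mathbb{Q})$, then $f$ satisfies the EWP but does not satisfy WP. (c) If $f$ has no pole in $\mathbb{P}^1(\mathbb{Q})$, then $f$ does not satisfy the EWP.
   Context: For $X\subseteq\mathbb{Q}$ and a positive integer $N$, write $X_N:=\{x_1+\cdots+x_N : x_1,\dots,x_N\in X\}$. $X$ is a base if $X_N=\mathbb{Q}$ for some $N\ge 1$; $X$ is a virtual base if for some $N\ge 1$ every rational number can be written as $\epsilon_1x_1+\cdots+\epsilon_Nx_N$ with $x_i\in X$ and $\epsilon_i\in\{1,-1\}$. For $f\in\mathbb{Q}(x)$, $f(\mathbb{Q})$ is the set of values $f(a)$ at $a\in\mathbb{Q}$ not a pole of $f$; $f$ satisfies WP if $f(\mathbb{Q})$ is a base and satisfies the EWP if $f(\mathbb{Q})$ is a virtual base. The degree of a rational function is the maximum of the degrees of numerator and denominator in lowest terms; poles are considered on the projective line including $\infty$. -}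

module Defs where

open import Data.Fin.Base using (Fin)
open import Data.List.Base using (List; []; _∷_; map; foldr)
open import Data.List.Relation.Unary.All using (all?)
open import Data.Nat.Base as ℕ using (ℕ; zero; suc; _⊔_)
open import Data.Product using (Σ; ∃-syntax; _×_)
open import Data.Rational using (ℚ; 0ℚ; 1ℚ; _+_; _*_; -_; _÷_; ≢-nonZero)
open import Data.Rational.Properties using (_≟_; +-0-commutativeMonoid)
open import Data.Sum.Base using (_⊎_)
open import Level using (0ℓ)
open import Relation.Binary.PropositionalEquality using (_≡_)
open import Relation.Nullary using (¬_; yes; no)
open import Relation.Unary using (Pred; _∈_)

open import Algebra.Properties.CommutativeMonoid.Sum +-0-commutativeMonoid
  using (sum)

-- Polynomials over ℚ as coefficient lists, constant term first.  Trailing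
-- zeros are allowed, so equality of polynomials is _≈_ rather than _≡_.

Poly : Set
Poly = List ℚ

coeff : Poly → ℕ → ℚ
coeff []      _       = 0ℚ
coeff (c ∷ _) zero    = c
coeff (_ ∷ p) (suc n) = coeff p n

infix 4 _≈_ _∣_

_≈_ : Poly → Poly → Set
p ≈ q = ∀ n → coeff p n ≡ coeff q n

eval : Poly → ℚ → ℚ
eval p a = foldr (λ c v → c + a * v) 0ℚ p

infixl 6 _⊕_
infixl 7 _⊗_

_⊕_ : Poly → Poly → Poly
[]      ⊕ q       = q
(c ∷ p) ⊕ []      = c ∷ p
(c ∷ p) ⊕ (d ∷ q) = c + d ∷ p ⊕ q

_⊗_ : Poly → Poly → Poly
[]      ⊗ _ = []
(c ∷ p) ⊗ q = map (c *_) q ⊕ (0ℚ ∷ p ⊗ q)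

-- Trailing zeros are ignored.  The zero polynomial gets degree 0; in a
-- fraction p / q with q nonzero this affects neither the maximum of the
-- degrees nor the condition deg q < deg p.

degree : Poly → ℕ
degree []      = 0
degree (_ ∷ p) with all? (_≟ 0ℚ) p
... | yes _ = 0
... | no  _ = suc (degree p)

_∣_ : Poly → Poly → Set
d ∣ p = ∃[ e ] p ≈ d ⊗ e

Coprime : Poly → Poly → Set
Coprime p q = ∀ d → d ∣ p → d ∣ q → degree d ≡ 0

-- An element of ℚ(x), given by a representation in lowest terms.  Every
-- element has one, unique up to a common nonzero constant factor.

record RationalFunction : Set where
  field
    num         : Poly
    den         : Poly
    den≉0       : ¬ den ≈ []
    lowestTerms : Coprime num den

open RationalFunction public

degreeᴿ : RationalFunction → ℕ
degreeᴿ f = degree (num f) ⊔ degree (den f)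

data P¹ℚ : Set where
  fin : ℚ → P¹ℚ
  ∞   : P¹ℚ

-- Because num f and den f have no common factor, no cancellation can occur
-- at a zero of den f.

IsPole : RationalFunction → Pred P¹ℚ 0ℓ
IsPole f (fin a) = eval (den f) a ≡ 0ℚ
IsPole f ∞       = degree (den f) ℕ.< degree (num f)

valueAt : (f : RationalFunction) (a : ℚ) → ¬ IsPole f (fin a) → ℚ
valueAt f a ¬pole = (eval (num f) a ÷ eval (den f) a) {{≢-nonZero ¬pole}}

ValueSet : RationalFunction → Pred ℚ 0ℓ
ValueSet f y = ∃[ a ] Σ (¬ IsPole f (fin a)) λ ¬pole → y ≡ valueAt f a ¬pole

SumsOf : ℕ → Pred ℚ 0ℓ → Pred ℚ 0ℓ
SumsOf N X r = Σ (Fin N → ℚ) λ x → (∀ i → x i ∈ X) × r ≡ sum x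

SignedSumsOf : ℕ → Pred ℚ 0ℓ → Pred ℚ 0ℓ
SignedSumsOf N X r =
  Σ (Fin N → ℚ) λ ε → Σ (Fin N → ℚ) λ x →
    (∀ i → ε i ≡ 1ℚ ⊎ ε i ≡ - 1ℚ) × (∀ i → x i ∈ X) ×
    r ≡ sum (λ i → ε i * x i)

IsBase : Pred ℚ 0ℓ → Set
IsBase X = ∃[ N ] 1 ℕ.≤ N × (∀ r → r ∈ SumsOf N X)

IsVirtualBase : Pred ℚ 0ℓ → Set
IsVirtualBase X = ∃[ N ] 1 ℕ.≤ N × (∀ r → r ∈ SignedSumsOf N X)

WP : RationalFunction → Set
WP f = IsBase (ValueSet f)

EWP : RationalFunction → Set
EWP f = IsVirtualBase (ValueSet f)

{-# OPTIONS --safe #-}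
module Submission where

-- Write f = P / Q with P and Q quadratic.  With two rational poles, a Möbius substitution
-- turns f into α t + β + γ / t with α ≠ 0, and triples of arguments whose reciprocals add up
-- to 0 make the last term disappear from sums.  With one rational pole it turns f into a
-- quadratic polynomial, for which differences F t − F (t − 1) are linear in t, while A F is
-- bounded below for the leading coefficient A.  Without rational poles the discriminant of Q
-- is not a square; up to squares it is an integer e that is −1 or is divisible exactly once
-- by some prime p (take p = 3 when e = −1).  Then u² − e v² is never divisible by p² for
-- coprime u and v, so the denominators of f(ℚ), and of all signed sums of values, have
-- bounded p-adic valuation.

open import Defs
open import Data.Fin.Base using (Fin; zero; suc)
open import Data.Fin.Patterns using (0F; 1F; 2F; 3F; 4F; 5F)
open import Data.Integer.Base as ℤ using (ℤ; +_; -[1+_]; 0ℤ; 1ℤ)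
open import Data.Integer.DivMod using (_/ℕ_; _%ℕ_; a≡a%ℕn+[a/ℕn]*n; n%ℕd<d)
open import Data.Integer.Divisibility.Signed
  using (divides; _∣?_; ∣-trans; ∣⇒∣ᵤ; ∣ᵤ⇒∣; ∣m∣n⇒∣m+n; ∣m∣n⇒∣m-n; ∣m⇒∣m*n)
  renaming (_∣_ to _∣ℤ_)
import Data.Integer.Properties as ℤ
import Data.Integer.Tactic.RingSolver as ℤ-solver
open import Data.List.Base using ([]; _∷_)
open import Data.List.Relation.Unary.All as All using (All; []; _∷_; all?)
open import Data.Maybe.Base using (Maybe; just; nothing)
open import Data.Nat.Base as ℕ using (ℕ; zero; suc)
import Data.Nat.Coprimality as ℕ
import Data.Nat.Divisibility as ℕ
open import Data.Nat.Induction using (<-wellFounded)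
open import Data.Nat.ListAction using (product)
open import Data.Nat.Primality
  using (Prime; euclidsLemma; prime?; ¬prime[1]; prime⇒nonZero; prime⇒nonTrivial)
open import Data.Nat.Primality.Factorisation using (factorise)
import Data.Nat.Properties as ℕ
import Data.Nat.Tactic.RingSolver as ℕ-solver
open import Data.Product using (∃; ∃₂; ∃!; ∃-syntax; _×_; _,_; proj₁; proj₂)
open import Data.Rational.Base
  using (ℚ; mkℚ; 0ℚ; 1ℚ; ½; _+_; _*_; _-_; -_; 1/_; _<_; _≤_; ∣_∣; ≢-nonZero; ↥_; ↧_; ↧ₙ_)
open import Data.Rational.Properties
open import Data.Rational.Unnormalised.Base using (*≡*)
import Data.Rational.Unnormalised.Properties as ℚᵘ
open import Data.Sum.Base using (_⊎_; inj₁; inj₂; [_,_]′)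
open import Data.Vec.Functional using () renaming ([] to []ᵛ; _∷_ to _∷ᵛ_)
open import Function.Base using (_∘_; id)
open import Induction.WellFounded using (Acc; acc)
open import Level using (0ℓ)
open import Relation.Binary.Definitions using (tri<; tri≈; tri>)
open import Relation.Binary.PropositionalEquality
open import Relation.Nullary using (¬_; yes; no; contradiction)
open import Relation.Nullary.Decidable using (toWitness; toWitnessFalse)
open import Relation.Unary using (Pred; _∈_)
open import Tactic.RingSolver using (solve-∀)
open import Tactic.RingSolver.Core.AlmostCommutativeRing
  using (AlmostCommutativeRing; fromCommutativeRing)

open import Algebra.Properties.CommutativeMonoid.Sum +-0-commutativeMonoid using (sum)

-- Arithmetic of rational numbers

ringℚ : AlmostCommutativeRing 0ℓ 0ℓ
ringℚ = fromCommutativeRing +-*-commutativeRing isZero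
  where
  isZero : ∀ x → Maybe (0ℚ ≡ x)
  isZero x with 0ℚ ≟ x
  ... | yes 0≡x = just 0≡x
  ... | no  _   = nothing

2ℚ 3ℚ 4ℚ 6ℚ : ℚ
2ℚ = 1ℚ + 1ℚ
3ℚ = 2ℚ + 1ℚ
4ℚ = 2ℚ + 2ℚ
6ℚ = 3ℚ + 3ℚ

x-y≡0⇒x≡y : ∀ {x y} → x - y ≡ 0ℚ → x ≡ y
x-y≡0⇒x≡y {x} {y} eq = trans (lem x y) (trans (cong (_+ y) eq) (+-identityˡ y))
  where
  lem : ∀ x y → x ≡ x - y + y
  lem = solve-∀ ringℚ

-- Hypotheses enter equational proofs by writing x − y as a combination of their differences,
-- an identity for the ring solver.
multiple-vanishes : ∀ {u v} k → u ≡ v → k * (u - v) ≡ 0ℚ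
multiple-vanishes {u} k refl = trans (cong (k *_) (+-inverseʳ u)) (*-zeroʳ k)

linear-combination : ∀ {x y u v} k → u ≡ v → x - y ≡ k * (u - v) → x ≡ y
linear-combination k u≡v eq = x-y≡0⇒x≡y (trans eq (multiple-vanishes k u≡v))

linear-combination₂ : ∀ {x y u v u′ v′} k k′ → u ≡ v → u′ ≡ v′ →
                      x - y ≡ k * (u - v) + k′ * (u′ - v′) → x ≡ y
linear-combination₂ k k′ u≡v u′≡v′ eq =
  x-y≡0⇒x≡y (trans eq (cong₂ _+_ (multiple-vanishes k u≡v) (multiple-vanishes k′ u′≡v′)))

inverse : ∀ {x} → x ≢ 0ℚ → ∃[ y ] x * y ≡ 1ℚ
inverse {x} x≢0 = (1/ x) , *-inverseʳ x
  where instance _ = ≢-nonZero x≢0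

unit⇒≢0 : ∀ {x y} → x * y ≡ 1ℚ → x ≢ 0ℚ
unit⇒≢0 {y = y} xy≡1 refl = contradiction (trans (sym xy≡1) (*-zeroˡ y)) λ ()

x*y≡0⇒y≡0 : ∀ {x y} → x ≢ 0ℚ → x * y ≡ 0ℚ → y ≡ 0ℚ
x*y≡0⇒y≡0 {x} {y} x≢0 xy≡0 with inverse x≢0
... | z , xz≡1 = linear-combination₂ z (- y) xy≡0 xz≡1 (lem x y z)
  where
  lem : ∀ x y z → y - 0ℚ ≡ z * (x * y - 0ℚ) + - y * (x * z - 1ℚ)
  lem = solve-∀ ringℚ

x*y≢0 : ∀ {x y} → x ≢ 0ℚ → y ≢ 0ℚ → x * y ≢ 0ℚ
x*y≢0 x≢0 y≢0 = y≢0 ∘ x*y≡0⇒y≡0 x≢0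

*-cancelʳ-≢0 : ∀ {x y z} → z ≢ 0ℚ → x * z ≡ y * z → x ≡ y
*-cancelʳ-≢0 {x} {y} {z} z≢0 xz≡yz with inverse z≢0
... | w , zw≡1 = linear-combination₂ w (y - x) xz≡yz zw≡1 (lem x y z w)
  where
  lem : ∀ x y z w → x - y ≡ w * (x * z - y * z) + (y - x) * (z * w - 1ℚ)
  lem = solve-∀ ringℚ

<⇒≱ : ∀ {p q} → p < q → ¬ q ≤ p
<⇒≱ p<q q≤p = <-irrefl refl (<-≤-trans p<q q≤p)

p≤∣p∣ : ∀ p → p ≤ ∣ p ∣
p≤∣p∣ p with ≤-total 0ℚ p
... | inj₁ 0≤p = ≤-reflexive (sym (0≤p⇒∣p∣≡p 0≤p))
... | inj₂ p≤0 = ≤-trans p≤0 (nonNegative⁻¹ ∣ p ∣ {{∣-∣-nonNeg p}})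

-- The substitutions below miss a few arguments, all of bounded size. A target can avoid them by
-- being split into two summands of opposite sign: `∣ r ∣ + M + 1ℚ` exceeds M, and what it leaves of
-- r is at most -M - 1.
split-beyond : ∀ r M → ∃₂ λ a b → a + b ≡ r × M < a × b < - M
split-beyond r M = ∣ r ∣ + M + 1ℚ , r - (∣ r ∣ + M + 1ℚ) , lem r (∣ r ∣ + M + 1ℚ) , M< , <-M
  where
  lem : ∀ r a → a + (r - a) ≡ r
  lem = solve-∀ ringℚ
  0≤∣r∣ : 0ℚ ≤ ∣ r ∣
  0≤∣r∣ = nonNegative⁻¹ ∣ r ∣ {{∣-∣-nonNeg r}}
  0<1 : 0ℚ < 1ℚ
  0<1 = toWitness {a? = 0ℚ <? 1ℚ} _
  M< : M < ∣ r ∣ + M + 1ℚ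
  M< = subst (_< ∣ r ∣ + M + 1ℚ) (trans (cong (_+ 0ℚ) (+-identityˡ M)) (+-identityʳ M))
         (+-mono-≤-< (+-monoˡ-≤ M 0≤∣r∣) 0<1)
  eq₁ : ∀ r a M → r - (a + M + 1ℚ) ≡ (r - a) + (- M) + - 1ℚ
  eq₁ = solve-∀ ringℚ
  eq₂ : ∀ a M → (a - a) + (- M) + 0ℚ ≡ - M
  eq₂ = solve-∀ ringℚ
  <-M : r - (∣ r ∣ + M + 1ℚ) < - M
  <-M = subst₂ _<_ (sym (eq₁ r ∣ r ∣ M)) (eq₂ ∣ r ∣ M)
          (+-mono-≤-< (+-monoˡ-≤ (- M) (+-monoˡ-≤ (- ∣ r ∣) (p≤∣p∣ r)))
             (toWitness {a? = - 1ℚ <? 0ℚ} _))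

-- Sums of values of a Laurent or quadratic polynomial

-- The arguments 2w and -w of the Laurent polynomial must differ from 1, and w must be invertible.
-- The forbidden w are ½, -1 and 0, none of which lies outside [-1, 1].
2w≢1 : ∀ {w} → 1ℚ < w ⊎ w < - 1ℚ → 2ℚ * w ≢ 1ℚ
2w≢1 {w} bound 2w≡1 = [ subst (¬_ ∘ (1ℚ <_)) (sym w≡½) (toWitnessFalse {a? = 1ℚ <? ½} _)
                      , subst (¬_ ∘ (_< - 1ℚ)) (sym w≡½) (toWitnessFalse {a? = ½ <? - 1ℚ} _)
                      ]′ bound
  where
  lem : ∀ w → w - ½ ≡ ½ * (2ℚ * w - 1ℚ)
  lem = solve-∀ ringℚ
  w≡½ : w ≡ ½
  w≡½ = linear-combination ½ 2w≡1 (lem w)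

-w≢1 : ∀ {w} → 1ℚ < w ⊎ w < - 1ℚ → - w ≢ 1ℚ
-w≢1 {w} bound -w≡1 = [ subst (¬_ ∘ (1ℚ <_)) (sym w≡-1) (toWitnessFalse {a? = 1ℚ <? - 1ℚ} _)
                      , subst (¬_ ∘ (_< - 1ℚ)) (sym w≡-1) (<-irrefl refl) ]′ bound
  where
  w≡-1 : w ≡ - 1ℚ
  w≡-1 = neg-injective -w≡1

w≢0 : ∀ {w} → 1ℚ < w ⊎ w < - 1ℚ → w ≢ 0ℚ
w≢0 bound refl = [ toWitnessFalse {a? = 1ℚ <? 0ℚ} _ , toWitnessFalse {a? = 0ℚ <? - 1ℚ} _ ]′ bound

-- The reciprocals of 2w, 2w, −w add up to 0 while their sum is 3w, so three values of
-- α t + β + γ / t already hit 3αw + 3β; two triples leave room to keep t away from 1.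
laurent⇒base : ∀ {X : Pred ℚ 0ℓ} α β γ → α ≢ 0ℚ →
               (∀ t u → t * u ≡ 1ℚ → t ≢ 1ℚ → α * t + β + γ * u ∈ X) → IsBase X
laurent⇒base {X} α β γ α≢0 value = 6 , ℕ.s≤s ℕ.z≤n , sums
  where
  α⁻¹ : ℚ
  α⁻¹ = proj₁ (inverse α≢0)
  αα⁻¹≡1 : α * α⁻¹ ≡ 1ℚ
  αα⁻¹≡1 = proj₂ (inverse α≢0)
  g : ℚ → ℚ → ℚ
  g t u = α * t + β + γ * u
  ⅓ : ℚ
  ⅓ = 1/ 3ℚ
  double : ∀ w h → (2ℚ * w) * (½ * h) - 1ℚ ≡ 1ℚ * (w * h - 1ℚ)
  double = solve-∀ ringℚ
  negate : ∀ w h → - w * - h - 1ℚ ≡ 1ℚ * (w * h - 1ℚ)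
  negate = solve-∀ ringℚ
  total : ∀ α β γ α⁻¹ r w₁ h₁ w₂ h₂ →
    r - ((α * (2ℚ * w₁) + β + γ * (½ * h₁)) + ((α * (2ℚ * w₁) + β + γ * (½ * h₁))
      + ((α * - w₁ + β + γ * - h₁) + ((α * (2ℚ * w₂) + β + γ * (½ * h₂))
      + ((α * (2ℚ * w₂) + β + γ * (½ * h₂)) + ((α * - w₂ + β + γ * - h₂) + 0ℚ))))))
      ≡ - (3ℚ * α) * (w₁ + w₂ - ⅓ * α⁻¹ * (r - 6ℚ * β))
        + - (r - 6ℚ * β) * (α * α⁻¹ - 1ℚ)
  total = solve-∀ ringℚ
  -- Since ½h + ½h - h = 0, the γ-terms cancel and the six values add up to 3α(w₁ + w₂) + 6β; this
  -- prescribes w₁ + w₂.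
  sums′ : ∀ r w₁ w₂ → w₁ + w₂ ≡ ⅓ * α⁻¹ * (r - 6ℚ * β) →
          1ℚ < w₁ ⊎ w₁ < - 1ℚ → 1ℚ < w₂ ⊎ w₂ < - 1ℚ → r ∈ SumsOf 6 X
  sums′ r w₁ w₂ w₁+w₂≡s b₁ b₂ = x , x∈X ,
    linear-combination₂ (- (3ℚ * α)) (- (r - 6ℚ * β)) w₁+w₂≡s αα⁻¹≡1
      (total α β γ α⁻¹ r w₁ h₁ w₂ h₂)
    where
    h₁ h₂ : ℚ
    h₁ = proj₁ (inverse (w≢0 b₁))
    h₂ = proj₁ (inverse (w≢0 b₂))
    e₁ : w₁ * h₁ ≡ 1ℚ
    e₁ = proj₂ (inverse (w≢0 b₁))
    e₂ : w₂ * h₂ ≡ 1ℚ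
    e₂ = proj₂ (inverse (w≢0 b₂))
    x : Fin 6 → ℚ
    x = g (2ℚ * w₁) (½ * h₁) ∷ᵛ g (2ℚ * w₁) (½ * h₁) ∷ᵛ g (- w₁) (- h₁)
      ∷ᵛ g (2ℚ * w₂) (½ * h₂) ∷ᵛ g (2ℚ * w₂) (½ * h₂) ∷ᵛ g (- w₂) (- h₂) ∷ᵛ []ᵛ
    d : ∀ {w h} → 1ℚ < w ⊎ w < - 1ℚ → w * h ≡ 1ℚ → g (2ℚ * w) (½ * h) ∈ X
    d {w} {h} b e = value _ _ (linear-combination 1ℚ e (double w h)) (2w≢1 b)
    n : ∀ {w h} → 1ℚ < w ⊎ w < - 1ℚ → w * h ≡ 1ℚ → g (- w) (- h) ∈ X
    n {w} {h} b e = value _ _ (linear-combination 1ℚ e (negate w h)) (-w≢1 b)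
    x∈X : ∀ i → x i ∈ X
    x∈X 0F = d b₁ e₁
    x∈X 1F = d b₁ e₁
    x∈X 2F = n b₁ e₁
    x∈X 3F = d b₂ e₂
    x∈X 4F = d b₂ e₂
    x∈X 5F = n b₂ e₂
  sums : ∀ r → r ∈ SumsOf 6 X
  sums r =
    let w₁ , w₂ , w₁+w₂≡s , 1<w₁ , w₂<-1 = split-beyond (⅓ * α⁻¹ * (r - 6ℚ * β)) 1ℚ
    in  sums′ r w₁ w₂ w₁+w₂≡s (inj₁ 1<w₁) (inj₂ w₂<-1)

-- A single difference F t - F (t - 1) = A (2t - 1) + B takes every value r, but for two r it would
-- use the excluded argument 0. Those satisfy |r| ≤ |A| + |B|, so r is first split into two parts
-- beyond that bound, each of which is a difference.
quadratic⇒virtualBase : ∀ {X : Pred ℚ 0ℓ} A B C → A ≢ 0ℚ →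
  (∀ t → t ≢ 0ℚ → A * (t * t) + B * t + C ∈ X) → IsVirtualBase X
quadratic⇒virtualBase {X} A B C A≢0 value = 4 , ℕ.s≤s ℕ.z≤n , sums
  where
  A⁻¹ : ℚ
  A⁻¹ = proj₁ (inverse A≢0)
  AA⁻¹≡1 : A * A⁻¹ ≡ 1ℚ
  AA⁻¹≡1 = proj₂ (inverse A≢0)
  F : ℚ → ℚ
  F t = A * (t * t) + B * t + C
  M : ℚ
  M = ∣ A ∣ + ∣ B ∣
  -- τ r and τ′ r = τ r − 1 solve F (τ r) − F (τ′ r) = r; they vanish for r = B ∓ A only.
  τ τ′ : ℚ → ℚ
  τ  r = ½ * ((r - B) * A⁻¹ + 1ℚ)
  τ′ r = ½ * ((r - B) * A⁻¹ - 1ℚ)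
  τ-root : ∀ A B A⁻¹ r →
    r - (B - A) ≡ (2ℚ * A) * (½ * ((r - B) * A⁻¹ + 1ℚ) - 0ℚ) + - (r - B) * (A * A⁻¹ - 1ℚ)
  τ-root = solve-∀ ringℚ
  τ′-root : ∀ A B A⁻¹ r →
    r - (B + A) ≡ (2ℚ * A) * (½ * ((r - B) * A⁻¹ - 1ℚ) - 0ℚ) + - (r - B) * (A * A⁻¹ - 1ℚ)
  τ′-root = solve-∀ ringℚ
  neg-involutive : ∀ p → - (- p) ≡ p
  neg-involutive = solve-∀ ringℚ
  large⇒≢ : ∀ {r} s → ∣ s ∣ ≤ M → M < r ⊎ r < - M → r ≢ s
  large⇒≢ s ∣s∣≤M (inj₁ M<s) refl = <⇒≱ M<s (≤-trans (p≤∣p∣ s) ∣s∣≤M)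
  large⇒≢ s ∣s∣≤M (inj₂ s<-M) refl =
    <⇒≱ (neg-antimono-< s<-M)
        (subst (- s ≤_) (sym (neg-involutive M))
               (≤-trans (p≤∣p∣ (- s)) (≤-trans (≤-reflexive (∣-p∣≡∣p∣ s)) ∣s∣≤M)))
  ∣B-A∣≤M : ∣ B - A ∣ ≤ M
  ∣B-A∣≤M = ≤-trans (∣p-q∣≤∣p∣+∣q∣ B A) (≤-reflexive (+-comm ∣ B ∣ ∣ A ∣))
  ∣B+A∣≤M : ∣ B + A ∣ ≤ M
  ∣B+A∣≤M = ≤-trans (∣p+q∣≤∣p∣+∣q∣ B A) (≤-reflexive (+-comm ∣ B ∣ ∣ A ∣))
  τ≢0 : ∀ {r} → M < r ⊎ r < - M → τ r ≢ 0ℚ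
  τ≢0 {r} b τ≡0 =
    large⇒≢ (B - A) ∣B-A∣≤M b
      (linear-combination₂ (2ℚ * A) (- (r - B)) τ≡0 AA⁻¹≡1 (τ-root A B A⁻¹ r))
  τ′≢0 : ∀ {r} → M < r ⊎ r < - M → τ′ r ≢ 0ℚ
  τ′≢0 {r} b τ′≡0 =
    large⇒≢ (B + A) ∣B+A∣≤M b
      (linear-combination₂ (2ℚ * A) (- (r - B)) τ′≡0 AA⁻¹≡1 (τ′-root A B A⁻¹ r))
  difference : ∀ A B C A⁻¹ r →
    let t = ½ * ((r - B) * A⁻¹ + 1ℚ) ; t′ = ½ * ((r - B) * A⁻¹ - 1ℚ) in
    r - (1ℚ * (A * (t * t) + B * t + C) + - 1ℚ * (A * (t′ * t′) + B * t′ + C))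
      ≡ - (r - B) * (A * A⁻¹ - 1ℚ)
  difference = solve-∀ ringℚ
  ε : Fin 4 → ℚ
  ε = 1ℚ ∷ᵛ - 1ℚ ∷ᵛ 1ℚ ∷ᵛ - 1ℚ ∷ᵛ []ᵛ
  regroup : ∀ a b c d → (1ℚ * a + - 1ℚ * b) + (1ℚ * c + - 1ℚ * d)
                          ≡ 1ℚ * a + (- 1ℚ * b + (1ℚ * c + (- 1ℚ * d + 0ℚ)))
  regroup = solve-∀ ringℚ
  r≡Fτ-Fτ′ : ∀ r → r ≡ 1ℚ * F (τ r) + - 1ℚ * F (τ′ r)
  r≡Fτ-Fτ′ r = linear-combination (- (r - B)) AA⁻¹≡1 (difference A B C A⁻¹ r)
  signed-sum : ∀ {r r₁ r₂} a b c d → r₁ + r₂ ≡ r →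
               r₁ ≡ 1ℚ * a + - 1ℚ * b → r₂ ≡ 1ℚ * c + - 1ℚ * d →
               r ≡ sum (λ i → ε i * (a ∷ᵛ b ∷ᵛ c ∷ᵛ d ∷ᵛ []ᵛ) i)
  signed-sum a b c d refl refl refl = regroup a b c d
  sums′ : ∀ r r₁ r₂ → r₁ + r₂ ≡ r → M < r₁ ⊎ r₁ < - M → M < r₂ ⊎ r₂ < - M →
          r ∈ SignedSumsOf 4 X
  sums′ r r₁ r₂ r₁+r₂≡r b₁ b₂ = ε , x , ε-sign , x∈X ,
    signed-sum (F (τ r₁)) (F (τ′ r₁)) (F (τ r₂)) (F (τ′ r₂)) r₁+r₂≡r
               (r≡Fτ-Fτ′ r₁) (r≡Fτ-Fτ′ r₂)
    where
    x : Fin 4 → ℚ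
    x = F (τ r₁) ∷ᵛ F (τ′ r₁) ∷ᵛ F (τ r₂) ∷ᵛ F (τ′ r₂) ∷ᵛ []ᵛ
    ε-sign : ∀ i → ε i ≡ 1ℚ ⊎ ε i ≡ - 1ℚ
    ε-sign 0F = inj₁ refl
    ε-sign 1F = inj₂ refl
    ε-sign 2F = inj₁ refl
    ε-sign 3F = inj₂ refl
    x∈X : ∀ i → x i ∈ X
    x∈X 0F = value _ (τ≢0 b₁)
    x∈X 1F = value _ (τ′≢0 b₁)
    x∈X 2F = value _ (τ≢0 b₂)
    x∈X 3F = value _ (τ′≢0 b₂)
  sums : ∀ r → r ∈ SignedSumsOf 4 X
  sums r =
    let r₁ , r₂ , r₁+r₂≡r , M<r₁ , r₂<-M = split-beyond r M
    in  sums′ r r₁ r₂ r₁+r₂≡r (inj₁ M<r₁) (inj₂ r₂<-M)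

-- Every sum of N elements, multiplied by c, is at least N m, so (N m - 1) / c is out of reach. A
-- negative c covers sets that are bounded above.
bounded-below⇒¬base : ∀ {X : Pred ℚ 0ℓ} c m → c ≢ 0ℚ → (∀ y → y ∈ X → m ≤ c * y) → ¬ IsBase X
bounded-below⇒¬base {X} c m c≢0 bound (N , _ , sums) with inverse c≢0
... | c⁻¹ , cc⁻¹≡1 with sums (c⁻¹ * (sum {N} (λ _ → m) - 1ℚ))
...   | x , x∈X , r≡Σx = <⇒≱ below (sum-bound x x∈X)
  where
  sum-bound : ∀ {n} (x : Fin n → ℚ) → (∀ i → x i ∈ X) → sum {n} (λ _ → m) ≤ c * sum x
  sum-bound {zero}  x x∈X = ≤-reflexive (sym (*-zeroʳ c))
  sum-bound {suc n} x x∈X =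
    ≤-trans (+-mono-≤ (bound _ (x∈X zero)) (sum-bound (x ∘ suc) (x∈X ∘ suc)))
            (≤-reflexive (sym (*-distribˡ-+ c _ _)))
  s : ℚ
  s = sum {N} (λ _ → m) - 1ℚ
  rescale : ∀ c c⁻¹ s → c * (c⁻¹ * s) - s ≡ s * (c * c⁻¹ - 1ℚ)
  rescale = solve-∀ ringℚ
  c*Σx≡ : c * sum x ≡ sum {N} (λ _ → m) - 1ℚ
  c*Σx≡ = trans (cong (c *_) (sym r≡Σx)) (linear-combination s cc⁻¹≡1 (rescale c c⁻¹ s))
  below : c * sum x < sum {N} (λ _ → m)
  below = subst₂ _<_ (sym c*Σx≡) (+-identityʳ _)
            (+-monoʳ-< (sum {N} (λ _ → m)) (toWitness {a? = - 1ℚ <? 0ℚ} _))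

0≤x*x : ∀ x → 0ℚ ≤ x * x
0≤x*x x = subst (0ℚ ≤_) (∣x∣²≡x² x) (subst (_≤ ∣ x ∣ * ∣ x ∣) (*-zeroˡ ∣ x ∣)
            (*-monoʳ-≤-nonNeg ∣ x ∣ {{∣-∣-nonNeg x}} (nonNegative⁻¹ ∣ x ∣ {{∣-∣-nonNeg x}})))
  where
  square-neg : ∀ x → - x * - x ≡ x * x
  square-neg = solve-∀ ringℚ
  ∣x∣²≡x² : ∀ x → ∣ x ∣ * ∣ x ∣ ≡ x * x
  ∣x∣²≡x² x with ∣p∣≡p∨∣p∣≡-p x
  ... | inj₁ eq = cong₂ _*_ eq eq
  ... | inj₂ eq = trans (cong₂ _*_ eq eq) (square-neg x)

-- Multiplying by A makes the leading coefficient the square A², so that completing the square gives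
-- a lower bound whatever the sign of A.
quadratic⇒¬base : ∀ {X : Pred ℚ 0ℓ} A B C → A ≢ 0ℚ →
  (∀ y → y ∈ X → ∃[ t ] y ≡ A * (t * t) + B * t + C) → ¬ IsBase X
quadratic⇒¬base {X} A B C A≢0 param = bounded-below⇒¬base A m A≢0 bound
  where
  m : ℚ
  m = A * C - (½ * B) * (½ * B)
  complete-square : ∀ A B C t →
    A * (A * (t * t) + B * t + C) ≡
      (A * t + ½ * B) * (A * t + ½ * B) + (A * C - (½ * B) * (½ * B))
  complete-square = solve-∀ ringℚ
  bound : ∀ y → y ∈ X → m ≤ A * y
  bound y y∈X with param y y∈X
  ... | t , refl = subst₂ _≤_ (+-identityˡ m) (sym (complete-square A B C t))
                     (+-monoˡ-≤ m (0≤x*x (A * t + ½ * B)))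

-- Nonsquares that stay nonsquare at a prime

prime-divisor : ∀ n → n ≢ 0 → n ≢ 1 → ∃[ p ] Prime p × p ℕ.∣ n
prime-divisor n n≢0 n≢1 with factorise n {{ℕ.≢-nonZero n≢0}}
... | record { factors = [] ; isFactorisation = n≡1 } = contradiction n≡1 n≢1
... | record { factors = p ∷ ps ; isFactorisation = n≡ ; factorsPrime = pr ∷ _ } =
  p , pr , ℕ.divides (product ps) (trans n≡ (ℕ.*-comm p (product ps)))

ExactDivisor : ℕ → ℕ → Set
ExactDivisor p n = Prime p × p ℕ.∣ n × ¬ p ℕ.* p ℕ.∣ n

-- Descent: as long as the prime divisor found divides n twice, p² is split off and p absorbed into
-- s. The process stops at 1 or at the first prime that divides exactly once; e need not be
-- squarefree.
square-times-exactly-divisible : ∀ n → n ≢ 0 →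
  ∃₂ λ s e → n ≡ s ℕ.* s ℕ.* e × (e ≡ 1 ⊎ ∃[ p ] ExactDivisor p e)
square-times-exactly-divisible n = go n (<-wellFounded n)
  where
  regroup : ∀ p s e → s ℕ.* s ℕ.* e ℕ.* (p ℕ.* p) ≡ (p ℕ.* s) ℕ.* (p ℕ.* s) ℕ.* e
  regroup = ℕ-solver.solve-∀
  go : ∀ n → Acc ℕ._<_ n → n ≢ 0 →
       ∃₂ λ s e → n ≡ s ℕ.* s ℕ.* e × (e ≡ 1 ⊎ ∃[ p ] ExactDivisor p e)
  go n (acc rec) n≢0 with n ℕ.≟ 1
  ... | yes n≡1 = 1 , n , sym (ℕ.+-identityʳ n) , inj₁ n≡1
  ... | no  n≢1 with prime-divisor n n≢0 n≢1
  ...   | p , p-prime , p∣n with p ℕ.* p ℕ.∣? n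
  ...     | no  p²∤n = 1 , n , sym (ℕ.+-identityʳ n) , inj₂ (p , p-prime , p∣n , p²∤n)
  ...     | yes (ℕ.divides m n≡mp²) with go m (rec m<n) m≢0
    where
    instance
      _ = prime⇒nonTrivial p-prime
      _ = prime⇒nonZero p-prime
    m≢0 : m ≢ 0
    m≢0 refl = n≢0 n≡mp²
    m<n : m ℕ.< n
    m<n = subst (m ℕ.<_) (sym n≡mp²)
            (ℕ.m<m*n m (p ℕ.* p) {{ℕ.≢-nonZero m≢0}}
              (ℕ.<-≤-trans (ℕ.nonTrivial⇒n>1 p) (ℕ.m≤m*n p p)))
  ...       | s , e , m≡s²e , e-exact =
    p ℕ.* s , e , trans n≡mp² (trans (cong (ℕ._* (p ℕ.* p)) m≡s²e) (regroup p s e)) , e-exact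

euclid : ∀ {p} → Prime p → ∀ i j → + p ∣ℤ i ℤ.* j → + p ∣ℤ i ⊎ + p ∣ℤ j
euclid {p} p-prime i j p∣ij =
  [ inj₁ ∘ ∣ᵤ⇒∣ , inj₂ ∘ ∣ᵤ⇒∣ ]′
    (euclidsLemma ℤ.∣ i ∣ ℤ.∣ j ∣ p-prime (subst (p ℕ.∣_) (ℤ.abs-* i j) (∣⇒∣ᵤ p∣ij)))

prime∤coprime : ∀ {p} → Prime p → ∀ {u v} → ℕ.Coprime ℤ.∣ u ∣ ℤ.∣ v ∣ → + p ∣ℤ u → ¬ + p ∣ℤ v
prime∤coprime p-prime u⊥v p∣u p∣v =
  ¬prime[1] (subst Prime (u⊥v (∣⇒∣ᵤ p∣u , ∣⇒∣ᵤ p∣v)) p-prime)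

-- A quantitative form of e not being a square in ℚₚ: norms of primitive vectors from
-- ℤ[√e] have p-adic valuation at most 1.
NonSquareAt : ℕ → ℤ → Set
NonSquareAt p e = ∀ {u v} → ℕ.Coprime ℤ.∣ u ∣ ℤ.∣ v ∣ →
                  ¬ + p ℤ.* + p ∣ℤ u ℤ.* u ℤ.- e ℤ.* (v ℤ.* v)

-- From p ∣ e and p² ∣ u² - e v² follows p ∣ u, hence p² ∣ u² and p² ∣ e v². As e = e′ p with p not
-- dividing e′, also p ∣ v, against coprimality.
exactDivisor⇒nonSquareAt : ∀ {p} e → ExactDivisor p ℤ.∣ e ∣ → NonSquareAt p e
exactDivisor⇒nonSquareAt {p} e (p-prime , p∣e , p²∤e) {u} {v} u⊥v p²∣N =
  go (∣ᵤ⇒∣ p∣e)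
  where
  P : ℤ
  P = + p
  instance _ = prime⇒nonZero p-prime
  go : ¬ P ∣ℤ e
  go (divides e′ e≡e′P) =
    [ p∤e′ , [ p∤v , p∤v ]′ ∘ euclid p-prime v v ]′ (euclid p-prime e′ (v ℤ.* v) p∣e′v²)
    where
    e-multiple : P ∣ℤ e
    e-multiple = divides e′ e≡e′P
    undo : ∀ a b → a ≡ (a ℤ.- b) ℤ.+ b
    undo = ℤ-solver.solve-∀
    p∣u² : P ∣ℤ u ℤ.* u
    p∣u² = subst (P ∣ℤ_) (sym (undo (u ℤ.* u) (e ℤ.* (v ℤ.* v))))
             (∣m∣n⇒∣m+n (∣-trans (divides P refl) p²∣N) (∣m⇒∣m*n (v ℤ.* v) e-multiple))
    p∣u : P ∣ℤ u
    p∣u = [ id , id ]′ (euclid p-prime u u p∣u²)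
    p∤v : ¬ P ∣ℤ v
    p∤v = prime∤coprime p-prime {u} {v} u⊥v p∣u
    p∤e′ : ¬ P ∣ℤ e′
    p∤e′ (divides e″ e′≡e″P) = p²∤e (subst (ℕ._∣ ℤ.∣ e ∣) (ℤ.abs-* P P)
      (∣⇒∣ᵤ (divides e″ (trans e≡e′P (trans (cong (ℤ._* P) e′≡e″P) (ℤ.*-assoc e″ P P))))))
    p²∣u² : P ℤ.* P ∣ℤ u ℤ.* u
    p²∣u² with p∣u
    ... | divides u′ refl = divides (u′ ℤ.* u′) (lem u′ P)
      where
      lem : ∀ a b → (a ℤ.* b) ℤ.* (a ℤ.* b) ≡ (a ℤ.* a) ℤ.* (b ℤ.* b)
      lem = ℤ-solver.solve-∀
    undo′ : ∀ a b → a ℤ.- (a ℤ.- b) ≡ b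
    undo′ = ℤ-solver.solve-∀
    p²∣ev² : P ℤ.* P ∣ℤ e ℤ.* (v ℤ.* v)
    p²∣ev² = subst (P ℤ.* P ∣ℤ_) (undo′ (u ℤ.* u) (e ℤ.* (v ℤ.* v))) (∣m∣n⇒∣m-n p²∣u² p²∣N)
    p∣e′v² : P ∣ℤ e′ ℤ.* (v ℤ.* v)
    p∣e′v² with p²∣ev²
    ... | divides t ev²≡tP² = divides t (ℤ.*-cancelʳ-≡ _ _ P
            (trans (lem e′ P (v ℤ.* v)) (trans (cong (ℤ._* (v ℤ.* v)) (sym e≡e′P))
              (trans ev²≡tP² (sym (ℤ.*-assoc t P P))))))
      where
      lem : ∀ a b c → (a ℤ.* c) ℤ.* b ≡ (a ℤ.* b) ℤ.* c
      lem = ℤ-solver.solve-∀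

prime[3] : Prime 3
prime[3] = toWitness {a? = prime? 3} _

square-mod-3 : ∀ i → + 3 ∣ℤ i ⊎ ∃[ k ] i ℤ.* i ≡ 1ℤ ℤ.+ k ℤ.* + 3
square-mod-3 i with i %ℕ 3 | n%ℕd<d i 3 | a≡a%ℕn+[a/ℕn]*n i 3
... | 0 | _ | i≡ = inj₁ (divides (i /ℕ 3) (trans i≡ (ℤ.+-identityˡ _)))
... | 1 | _ | i≡ = inj₂ (+ 2 ℤ.* (i /ℕ 3) ℤ.+ + 3 ℤ.* (i /ℕ 3 ℤ.* (i /ℕ 3)) ,
                      trans (cong₂ ℤ._*_ i≡ i≡) (lem (i /ℕ 3)))
  where
  lem : ∀ q → (1ℤ ℤ.+ q ℤ.* + 3) ℤ.* (1ℤ ℤ.+ q ℤ.* + 3)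
                ≡ 1ℤ ℤ.+ (+ 2 ℤ.* q ℤ.+ + 3 ℤ.* (q ℤ.* q)) ℤ.* + 3
  lem = ℤ-solver.solve-∀
... | 2 | _ | i≡ = inj₂ (1ℤ ℤ.+ + 4 ℤ.* (i /ℕ 3) ℤ.+ + 3 ℤ.* (i /ℕ 3 ℤ.* (i /ℕ 3)) ,
                      trans (cong₂ ℤ._*_ i≡ i≡) (lem (i /ℕ 3)))
  where
  lem : ∀ q → (+ 2 ℤ.+ q ℤ.* + 3) ℤ.* (+ 2 ℤ.+ q ℤ.* + 3)
                ≡ 1ℤ ℤ.+ (1ℤ ℤ.+ + 4 ℤ.* q ℤ.+ + 3 ℤ.* (q ℤ.* q)) ℤ.* + 3
  lem = ℤ-solver.solve-∀
... | suc (suc (suc _)) | ℕ.s≤s (ℕ.s≤s (ℕ.s≤s ())) | _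

-- Squares are 0 or 1 modulo 3, so u² + v² is divisible by 3 only if both u and v are. Divisibility
-- by 9 is used only through divisibility by 3.
-1-nonSquareAt-3 : NonSquareAt 3 -[1+ 0 ]
-1-nonSquareAt-3 {u} {v} u⊥v 9∣N = go (square-mod-3 u) (square-mod-3 v)
  where
  norm : ∀ u v → u ℤ.* u ℤ.- -[1+ 0 ] ℤ.* (v ℤ.* v) ≡ u ℤ.* u ℤ.+ v ℤ.* v
  norm = ℤ-solver.solve-∀
  3∣u²+v² : + 3 ∣ℤ u ℤ.* u ℤ.+ v ℤ.* v
  3∣u²+v² = subst (+ 3 ∣ℤ_) (norm u v) (∣-trans (divides (+ 3) refl) 9∣N)
  remainder : ∀ r k → u ℤ.* u ℤ.+ v ℤ.* v ≡ r ℤ.+ k ℤ.* + 3 → + 3 ∣ℤ r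
  remainder r k eq = subst (+ 3 ∣ℤ_) (undo r (k ℤ.* + 3))
    (∣m∣n⇒∣m-n (subst (+ 3 ∣ℤ_) eq 3∣u²+v²) (divides k refl))
    where
    undo : ∀ r k → r ℤ.+ k ℤ.- k ≡ r
    undo = ℤ-solver.solve-∀
  go : + 3 ∣ℤ u ⊎ ∃[ k ] u ℤ.* u ≡ 1ℤ ℤ.+ k ℤ.* + 3 →
       ¬ (+ 3 ∣ℤ v ⊎ ∃[ k ] v ℤ.* v ≡ 1ℤ ℤ.+ k ℤ.* + 3)
  go (inj₁ 3∣u) (inj₁ 3∣v) = prime∤coprime prime[3] {u} {v} u⊥v 3∣u 3∣v
  go (inj₁ (divides a u≡)) (inj₂ (k , v²≡)) =
    toWitnessFalse {a? = + 3 ∣? 1ℤ} _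
      (remainder 1ℤ (+ 3 ℤ.* (a ℤ.* a) ℤ.+ k)
        (trans (cong₂ ℤ._+_ (cong₂ ℤ._*_ u≡ u≡) v²≡) (lem a k)))
    where
    lem : ∀ a k → (a ℤ.* + 3) ℤ.* (a ℤ.* + 3) ℤ.+ (1ℤ ℤ.+ k ℤ.* + 3)
                    ≡ 1ℤ ℤ.+ (+ 3 ℤ.* (a ℤ.* a) ℤ.+ k) ℤ.* + 3
    lem = ℤ-solver.solve-∀
  go (inj₂ (k , u²≡)) (inj₁ (divides a v≡)) =
    toWitnessFalse {a? = + 3 ∣? 1ℤ} _
      (remainder 1ℤ (+ 3 ℤ.* (a ℤ.* a) ℤ.+ k)
        (trans (cong₂ ℤ._+_ u²≡ (cong₂ ℤ._*_ v≡ v≡)) (lem a k)))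
    where
    lem : ∀ a k → (1ℤ ℤ.+ k ℤ.* + 3) ℤ.+ (a ℤ.* + 3) ℤ.* (a ℤ.* + 3)
                    ≡ 1ℤ ℤ.+ (+ 3 ℤ.* (a ℤ.* a) ℤ.+ k) ℤ.* + 3
    lem = ℤ-solver.solve-∀
  go (inj₂ (k , u²≡)) (inj₂ (l , v²≡)) =
    toWitnessFalse {a? = + 3 ∣? + 2} _
      (remainder (+ 2) (k ℤ.+ l) (trans (cong₂ ℤ._+_ u²≡ v²≡) (lem k l)))
    where
    lem : ∀ k l → (1ℤ ℤ.+ k ℤ.* + 3) ℤ.+ (1ℤ ℤ.+ l ℤ.* + 3) ≡ + 2 ℤ.+ (k ℤ.+ l) ℤ.* + 3
    lem = ℤ-solver.solve-∀

-- p-integral rationals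

-- The denominator is literally 1, so numerators compute and injectivity is immediate.
fromℤ : ℤ → ℚ
fromℤ i = mkℚ i 0 (ℕ.sym (ℕ.1-coprimeTo ℤ.∣ i ∣))

fromℤ-injective : ∀ {i j} → fromℤ i ≡ fromℤ j → i ≡ j
fromℤ-injective = cong ↥_

fromℤ-homo-+ : ∀ i j → fromℤ (i ℤ.+ j) ≡ fromℤ i + fromℤ j
fromℤ-homo-+ i j = sym (toℚᵘ-injective
  (ℚᵘ.≃-trans (toℚᵘ-homo-+ (fromℤ i) (fromℤ j)) (*≡* (lem i j))))
  where
  lem : ∀ i j → (i ℤ.* 1ℤ ℤ.+ j ℤ.* 1ℤ) ℤ.* 1ℤ ≡ (i ℤ.+ j) ℤ.* 1ℤ
  lem = ℤ-solver.solve-∀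

fromℤ-homo-* : ∀ i j → fromℤ (i ℤ.* j) ≡ fromℤ i * fromℤ j
fromℤ-homo-* i j = sym (toℚᵘ-injective
  (ℚᵘ.≃-trans (toℚᵘ-homo-* (fromℤ i) (fromℤ j)) (*≡* refl)))

fromℤ-homo-neg : ∀ i → fromℤ (ℤ.- i) ≡ - fromℤ i
fromℤ-homo-neg i = toℚᵘ-injective (ℚᵘ.≃-sym (ℚᵘ.≃-trans (toℚᵘ-homo‿- (fromℤ i)) (*≡* refl)))

fromℤ≢0 : ∀ {i} → i ≢ 0ℤ → fromℤ i ≢ 0ℚ
fromℤ≢0 i≢0 = i≢0 ∘ fromℤ-injective

x*↧x≡↥x : ∀ x → x * fromℤ (↧ x) ≡ fromℤ (↥ x)
x*↧x≡↥x x@record{} = toℚᵘ-injective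
  (ℚᵘ.≃-trans (toℚᵘ-homo-* x (fromℤ (↧ x)))
    (*≡* (trans (ℤ.*-identityʳ _)
      (cong (λ n → ↥ x ℤ.* + n) (sym (ℕ.*-identityʳ (↧ₙ x)))))))

-- Membership in the localisation ℤ₍ₚ₎.
record Integral (p : ℕ) (z : ℚ) : Set where
  constructor fraction
  field
    multiplier value : ℤ
    p∤multiplier     : ¬ + p ∣ℤ multiplier
    multiple         : fromℤ multiplier * z ≡ fromℤ value

module _ {p} (p-prime : Prime p) where

  p∤1 : ¬ + p ∣ℤ 1ℤ
  p∤1 p∣1 = ¬prime[1] (subst Prime (ℕ.∣1⇒≡1 (∣⇒∣ᵤ p∣1)) p-prime)

  integral-0 : Integral p 0ℚ
  integral-0 = fraction 1ℤ 0ℤ p∤1 refl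

  integral-+ : ∀ {x y} → Integral p x → Integral p y → Integral p (x + y)
  integral-+ {x} {y} (fraction w m p∤w wx≡m) (fraction w′ m′ p∤w′ w′y≡m′) =
    fraction (w ℤ.* w′) (w′ ℤ.* m ℤ.+ w ℤ.* m′) ([ p∤w , p∤w′ ]′ ∘ euclid p-prime w w′) (begin
      fromℤ (w ℤ.* w′) * (x + y)
        ≡⟨ cong (_* (x + y)) (fromℤ-homo-* w w′) ⟩
      fromℤ w * fromℤ w′ * (x + y)
        ≡⟨ lem (fromℤ w) (fromℤ w′) x y ⟩
      fromℤ w′ * (fromℤ w * x) + fromℤ w * (fromℤ w′ * y)
        ≡⟨ cong₂ (λ a b → fromℤ w′ * a + fromℤ w * b) wx≡m w′y≡m′ ⟩
      fromℤ w′ * fromℤ m + fromℤ w * fromℤ m′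
        ≡⟨ cong₂ _+_ (fromℤ-homo-* w′ m) (fromℤ-homo-* w m′) ⟨
      fromℤ (w′ ℤ.* m) + fromℤ (w ℤ.* m′)
        ≡⟨ fromℤ-homo-+ (w′ ℤ.* m) (w ℤ.* m′) ⟨
      fromℤ (w′ ℤ.* m ℤ.+ w ℤ.* m′) ∎)
    where
    open ≡-Reasoning
    lem : ∀ w w′ x y → w * w′ * (x + y) ≡ w′ * (w * x) + w * (w′ * y)
    lem = solve-∀ ringℚ

  integral-neg : ∀ {x} → Integral p x → Integral p (- x)
  integral-neg {x} (fraction w m p∤w wx≡m) = fraction w (ℤ.- m) p∤w
    (trans (sym (neg-distribʳ-* (fromℤ w) x)) (trans (cong -_ wx≡m) (sym (fromℤ-homo-neg m))))

  -- Multiplying w z = m by p turns it into w = m p, which contradicts that p does not divide w.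
  ¬integral-1/p : ∀ {z} → fromℤ (+ p) * z ≡ 1ℚ → ¬ Integral p z
  ¬integral-1/p {z} pz≡1 (fraction w m p∤w wz≡m) = p∤w (divides m (fromℤ-injective (begin
      fromℤ w
        ≡⟨ linear-combination₂ (- fromℤ w) (fromℤ (+ p)) pz≡1 wz≡m
             (lem (fromℤ w) (fromℤ (+ p)) z (fromℤ m)) ⟩
      fromℤ m * fromℤ (+ p)
        ≡⟨ fromℤ-homo-* m (+ p) ⟨
      fromℤ (m ℤ.* + p) ∎)))
    where
    open ≡-Reasoning
    lem : ∀ w p z m → w - m * p ≡ - w * (p * z - 1ℚ) + p * (w * z - m)
    lem = solve-∀ ringℚ

  -- The localisation is closed under addition and negation, so c times any signed sum stays in it,
  -- whatever the number of terms. Hence 1 / (c p) is never a signed sum.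
  integral-multiples⇒¬virtualBase : ∀ {X : Pred ℚ 0ℓ} c → c ≢ 0ℚ →
    (∀ y → y ∈ X → Integral p (c * y)) → ¬ IsVirtualBase X
  integral-multiples⇒¬virtualBase {X} c c≢0 integral (N , _ , sums) =
    let c⁻¹ , cc⁻¹≡1 = inverse c≢0
        p⁻¹ , pp⁻¹≡1 = inverse {fromℤ (+ p)} (fromℤ≢0 p≢0)
        ε , x , ε-sign , x∈X , r≡Σ = sums (c⁻¹ * p⁻¹)
    in  ¬integral-1/p pp⁻¹≡1
          (subst (Integral p)
                 (trans (cong (c *_) (sym r≡Σ)) (linear-combination p⁻¹ cc⁻¹≡1 (lem c c⁻¹ p⁻¹)))
                 (integral-sum ε x ε-sign x∈X))
    where
    p≢0 : + p ≢ 0ℤ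
    p≢0 = ℕ.≢-nonZero⁻¹ p {{prime⇒nonZero p-prime}} ∘ ℤ.+-injective
    lem : ∀ c c⁻¹ p⁻¹ → c * (c⁻¹ * p⁻¹) - p⁻¹ ≡ p⁻¹ * (c * c⁻¹ - 1ℚ)
    lem = solve-∀ ringℚ
    positive-term : ∀ c y → c * y ≡ c * (1ℚ * y)
    positive-term = solve-∀ ringℚ
    negative-term : ∀ c y → - (c * y) ≡ c * (- 1ℚ * y)
    negative-term = solve-∀ ringℚ
    integral-term : ∀ {ε y} → ε ≡ 1ℚ ⊎ ε ≡ - 1ℚ → y ∈ X → Integral p (c * (ε * y))
    integral-term {y = y} (inj₁ refl) y∈X = subst (Integral p) (positive-term c y) (integral y y∈X)
    integral-term {y = y} (inj₂ refl) y∈X =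
      subst (Integral p) (negative-term c y) (integral-neg (integral y y∈X))
    integral-sum : ∀ {n} (ε x : Fin n → ℚ) → (∀ i → ε i ≡ 1ℚ ⊎ ε i ≡ - 1ℚ) → (∀ i → x i ∈ X) →
                   Integral p (c * sum (λ i → ε i * x i))
    integral-sum {zero}  ε x ε-sign x∈X = subst (Integral p) (sym (*-zeroʳ c)) integral-0
    integral-sum {suc n} ε x ε-sign x∈X =
      subst (Integral p) (sym (*-distribˡ-+ c (ε zero * x zero)
                                           (sum (λ i → ε (suc i) * x (suc i)))))
        (integral-+ (integral-term (ε-sign zero) (x∈X zero))
                    (integral-sum (ε ∘ suc) (x ∘ suc) (ε-sign ∘ suc) (x∈X ∘ suc)))

-- Integers and rationals modulo squares

-- The decomposition of |d| is combined with the sign of d. Exact divisibility by p ignores signs,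
-- so only the remainder -1 is new; the prime 3 serves for it.
square-times-locally-nonsquare : ∀ d → d ≢ 0ℤ →
  ∃₂ λ s e → d ≡ s ℤ.* s ℤ.* e × (e ≡ 1ℤ ⊎ ∃[ p ] Prime p × NonSquareAt p e)
square-times-locally-nonsquare d d≢0 with square-times-exactly-divisible ℤ.∣ d ∣ (d≢0 ∘ ℤ.∣i∣≡0⇒i≡0)
... | s , e , ∣d∣≡s²e , e-cases = go (ℤ.+∣i∣≡i⊎+∣i∣≡-i d) e-cases
  where
  +∣d∣≡ : + ℤ.∣ d ∣ ≡ + s ℤ.* + s ℤ.* + e
  +∣d∣≡ = trans (cong +_ ∣d∣≡s²e)
            (trans (ℤ.pos-* (s ℕ.* s) e) (cong (ℤ._* + e) (ℤ.pos-* s s)))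
  d≡-s²e : + ℤ.∣ d ∣ ≡ ℤ.- d → d ≡ + s ℤ.* + s ℤ.* ℤ.- + e
  d≡-s²e eq = trans (sym (ℤ.neg-involutive d)) (trans (cong ℤ.-_ (trans (sym eq) +∣d∣≡))
                (ℤ.neg-distribʳ-* (+ s ℤ.* + s) (+ e)))
  go : + ℤ.∣ d ∣ ≡ d ⊎ + ℤ.∣ d ∣ ≡ ℤ.- d → e ≡ 1 ⊎ (∃[ p ] ExactDivisor p e) →
       ∃₂ λ s e → d ≡ s ℤ.* s ℤ.* e × (e ≡ 1ℤ ⊎ ∃[ p ] Prime p × NonSquareAt p e)
  go (inj₁ eq) (inj₁ e≡1) = + s , + e , trans (sym eq) +∣d∣≡ , inj₁ (cong +_ e≡1)
  go (inj₁ eq) (inj₂ (p , exact)) = + s , + e , trans (sym eq) +∣d∣≡ ,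
    inj₂ (p , proj₁ exact , λ {u} {v} → exactDivisor⇒nonSquareAt (+ e) exact {u} {v})
  go (inj₂ eq) (inj₁ refl) = + s , -[1+ 0 ] , d≡-s²e eq ,
    inj₂ (3 , prime[3] , λ {u} {v} → -1-nonSquareAt-3 {u} {v})
  go (inj₂ eq) (inj₂ (p , exact)) = + s , ℤ.- + e , d≡-s²e eq ,
    inj₂ (p , proj₁ exact , λ {u} {v} → exactDivisor⇒nonSquareAt (ℤ.- + e)
      (subst (ExactDivisor p) (sym (ℤ.∣-i∣≡∣i∣ (+ e))) exact) {u} {v})

-- The class of D modulo nonzero rational squares contains an integer e that is not a square
-- p-adically; k is the scaling between the two.
record RescalesToNonSquare (D : ℚ) : Set where
  field
    p         : ℕ
    p-prime   : Prime p
    k         : ℚ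
    k≢0       : k ≢ 0ℚ
    e         : ℤ
    k²D≡e     : k * k * D ≡ fromℤ e
    nonSquare : NonSquareAt p e

-- For D = n / m the integer d = n m equals D m². Write d = s² e. If e = 1, then D is the square of
-- s / m; otherwise k = m / s gives k² D = e.
nonSquare⇒rescalesToNonSquare : ∀ D → (∀ y → y * y ≢ D) → RescalesToNonSquare D
nonSquare⇒rescalesToNonSquare D nonSquare = go (square-times-locally-nonsquare d d≢0)
  where
  m d : ℤ
  m = ↧ D
  d = ↥ D ℤ.* m
  m≢0 : fromℤ m ≢ 0ℚ
  m≢0 = fromℤ≢0 (λ ())
  Dm² : fromℤ d ≡ D * fromℤ m * fromℤ m
  Dm² = trans (fromℤ-homo-* (↥ D) m) (cong (_* fromℤ m) (sym (x*↧x≡↥x D)))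
  D≢0 : D ≢ 0ℚ
  D≢0 D≡0 = nonSquare 0ℚ (sym D≡0)
  d≢0 : d ≢ 0ℤ
  d≢0 d≡0 = x*y≢0 (x*y≢0 D≢0 m≢0) m≢0 (trans (sym Dm²) (cong fromℤ d≡0))
  m⁻¹ : ℚ
  m⁻¹ = proj₁ (inverse m≢0)
  mm⁻¹≡1 : fromℤ m * m⁻¹ ≡ 1ℚ
  mm⁻¹≡1 = proj₂ (inverse m≢0)
  root : ∀ D m m⁻¹ s → s * m⁻¹ * (s * m⁻¹) - D
           ≡ - (m⁻¹ * m⁻¹) * (D * m * m - s * s * 1ℚ) + D * (m * m⁻¹ + 1ℚ) * (m * m⁻¹ - 1ℚ)
  root = solve-∀ ringℚ
  scale : ∀ D m s s⁻¹ e → m * s⁻¹ * (m * s⁻¹) * D - e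
            ≡ s⁻¹ * s⁻¹ * (D * m * m - s * s * e) + e * (s * s⁻¹ + 1ℚ) * (s * s⁻¹ - 1ℚ)
  scale = solve-∀ ringℚ
  Dm²≡s²e : ∀ s e → d ≡ s ℤ.* s ℤ.* e → D * fromℤ m * fromℤ m ≡ fromℤ s * fromℤ s * fromℤ e
  Dm²≡s²e s e d≡s²e = trans (sym Dm²) (trans (cong fromℤ d≡s²e)
    (trans (fromℤ-homo-* (s ℤ.* s) e) (cong (_* fromℤ e) (fromℤ-homo-* s s))))
  go : (∃₂ λ s e → d ≡ s ℤ.* s ℤ.* e × (e ≡ 1ℤ ⊎ ∃[ p ] Prime p × NonSquareAt p e)) →
       RescalesToNonSquare D
  go (s , .1ℤ , d≡s²e , inj₁ refl) = contradiction
    (linear-combination₂ (- (m⁻¹ * m⁻¹)) (D * (fromℤ m * m⁻¹ + 1ℚ)) (Dm²≡s²e s 1ℤ d≡s²e) mm⁻¹≡1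
      (root D (fromℤ m) m⁻¹ (fromℤ s)))
    (nonSquare (fromℤ s * m⁻¹))
  go (s , e , d≡s²e , inj₂ (p , p-prime , nonSquare)) = record
    { p = p
    ; p-prime = p-prime
    ; k = fromℤ m * s⁻¹
    ; k≢0 = x*y≢0 {fromℤ m} {s⁻¹} m≢0
        (unit⇒≢0 {s⁻¹} {fromℤ s} (trans (*-comm s⁻¹ (fromℤ s)) ss⁻¹≡1))
    ; e = e
    ; k²D≡e = linear-combination₂ (s⁻¹ * s⁻¹) (fromℤ e * (fromℤ s * s⁻¹ + 1ℚ))
                (Dm²≡s²e s e d≡s²e) ss⁻¹≡1
                (scale D (fromℤ m) (fromℤ s) s⁻¹ (fromℤ e))
    ; nonSquare = λ {u} {v} → nonSquare {u} {v}
    }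
    where
    s≢0 : s ≢ 0ℤ
    s≢0 refl = d≢0 d≡s²e
    s⁻¹ : ℚ
    s⁻¹ = proj₁ (inverse (fromℤ≢0 s≢0))
    ss⁻¹≡1 : fromℤ s * s⁻¹ ≡ 1ℚ
    ss⁻¹≡1 = proj₂ (inverse (fromℤ≢0 s≢0))

-- Integer values and common denominators

record IsInteger (z : ℚ) : Set where
  constructor integer
  field
    toℤ      : ℤ
    isFromℤ  : z ≡ fromℤ toℤ

fromℤ-isInteger : ∀ i → IsInteger (fromℤ i)
fromℤ-isInteger i = integer i refl

isInteger-+ : ∀ {x y} → IsInteger x → IsInteger y → IsInteger (x + y)
isInteger-+ (integer i refl) (integer j refl) = integer (i ℤ.+ j) (sym (fromℤ-homo-+ i j))

isInteger-* : ∀ {x y} → IsInteger x → IsInteger y → IsInteger (x * y)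
isInteger-* (integer i refl) (integer j refl) = integer (i ℤ.* j) (sym (fromℤ-homo-* i j))

CommonDenominator : ℤ → Pred ℚ 0ℓ
CommonDenominator T x = IsInteger (fromℤ T * x)

↧-denominator : ∀ x → CommonDenominator (↧ x) x
↧-denominator x = integer (↥ x) (trans (*-comm (fromℤ (↧ x)) x) (x*↧x≡↥x x))

denominator-*ʳ : ∀ {T} U {x} → CommonDenominator T x → CommonDenominator (T ℤ.* U) x
denominator-*ʳ {T} U {x} d = subst IsInteger
  (trans (lem (fromℤ T) (fromℤ U) x) (cong (_* x) (sym (fromℤ-homo-* T U))))
  (isInteger-* (fromℤ-isInteger U) d)
  where
  lem : ∀ t u x → u * (t * x) ≡ t * u * x
  lem = solve-∀ ringℚ

denominator-*ˡ : ∀ T {U x} → CommonDenominator U x → CommonDenominator (T ℤ.* U) x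
denominator-*ˡ T {U} {x} d =
  subst (λ V → CommonDenominator V x) (ℤ.*-comm U T) (denominator-*ʳ {U} T {x} d)

lowest-terms : ∀ z → ℕ.Coprime ℤ.∣ ↥ z ∣ ℤ.∣ ↧ z ∣
lowest-terms (mkℚ n d-1 n⊥d) = ℕ.recompute n⊥d

common-denominator : ∀ xs → ∃[ T ] fromℤ T ≢ 0ℚ × All (CommonDenominator T) xs
common-denominator []       = 1ℤ , (λ ()) , []
common-denominator (x ∷ xs) =
  let T , T≢0 , T-clears = common-denominator xs
  in  ↧ x ℤ.* T ,
      subst (_≢ 0ℚ) (sym (fromℤ-homo-* (↧ x) T)) (x*y≢0 {fromℤ (↧ x)} (fromℤ≢0 (λ ())) T≢0) ,
      denominator-*ʳ {↧ x} T {x} (↧-denominator x)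
        ∷ All.map (λ {y} → denominator-*ˡ (↧ x) {T} {y}) T-clears

-- Quotients with an irreducible quadratic denominator

quad : ℚ → ℚ → ℚ → ℚ → ℚ
quad c₀ c₁ c₂ x = c₀ + c₁ * x + c₂ * (x * x)

-- At most one factor p occurs in w, and the factor p in front of z absorbs it: the multiplier is w
-- itself if p does not divide w, and w / p otherwise.
p∥denominator⇒integral : ∀ {p} → Prime p → ∀ w z → ¬ + p ℤ.* + p ∣ℤ w →
                         IsInteger (fromℤ w * z) → Integral p (fromℤ (+ p) * z)
p∥denominator⇒integral {p} p-prime w z p²∤w (integer N wz≡N) with + p ∣? w
... | no p∤w = fraction w (+ p ℤ.* N) p∤w
  (trans (lem (fromℤ w) (fromℤ (+ p)) z)
    (trans (cong (fromℤ (+ p) *_) wz≡N) (sym (fromℤ-homo-* (+ p) N))))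
  where
  lem : ∀ w p z → w * (p * z) ≡ p * (w * z)
  lem = solve-∀ ringℚ
... | yes (divides w′ refl) = fraction w′ N p∤w′
  (trans (sym (*-assoc (fromℤ w′) (fromℤ (+ p)) z))
    (trans (cong (_* z) (sym (fromℤ-homo-* w′ (+ p)))) wz≡N))
  where
  p∤w′ : ¬ + p ∣ℤ w′
  p∤w′ (divides w″ w′≡w″p) =
    p²∤w (divides w″ (trans (cong (ℤ._* + p) w′≡w″p) (ℤ.*-assoc w″ (+ p) (+ p))))

-- Putting z = k (2 q₂ x + q₁) = u / v, the denominator v² Q(x) becomes u² − e v² up to a
-- constant factor; v² P(x) becomes a binary quadratic form in u and v, and T clears the
-- denominators of its coefficients.
norm-form-denominator : ∀ p₀ p₁ p₂ q₀ q₁ q₂ T k h x v y {u e m} →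
  u ≡ k * (2ℚ * q₂ * x + q₁) * v → e ≡ k * k * (q₁ * q₁ - 4ℚ * q₀ * q₂) →
  2ℚ * q₂ * k * h ≡ 1ℚ →
  y * (q₀ + q₁ * x + q₂ * (x * x)) ≡ p₀ + p₁ * x + p₂ * (x * x) →
  m ≡ T * h * u + T * - (q₁ * k * h) * v →
  (u * u - e * (v * v)) * (T * T * T * (q₂ * (h * h)) * y)
    ≡ T * p₀ * (T * v * (T * v)) + T * p₁ * (T * v * m) + T * p₂ * (m * m)
norm-form-denominator p₀ p₁ p₂ q₀ q₁ q₂ T k h x v y {m = m} refl refl unit value m≡ =
  -- The form u² - e v² is 4 k² q₂ v² Q(x), and 2 q₂ k h = 1, so the factor q₂ h² turns it into v²
  -- Q(x). In T³, one T goes with each coefficient of P and two go with the products of v and v x.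
  trans (linear-combination₂
           (T * T * T * (v * v) * (y * (q₀ + q₁ * x + q₂ * (x * x))) * (2ℚ * q₂ * k * h + 1ℚ))
           (T * T * T * (v * v)) unit value (lem p₀ p₁ p₂ q₀ q₁ q₂ T k h x v y))
        (cong (λ m → T * p₀ * (T * v * (T * v)) + T * p₁ * (T * v * m) + T * p₂ * (m * m))
              (sym m≡Tvx))
  where
  m-lem : ∀ q₁ q₂ T k h x v →
    T * h * (k * (2ℚ * q₂ * x + q₁) * v) + T * - (q₁ * k * h) * v - T * v * x
      ≡ T * v * x * (2ℚ * q₂ * k * h - 1ℚ)
  m-lem = solve-∀ ringℚ
  m≡Tvx : m ≡ T * v * x
  m≡Tvx = trans m≡ (linear-combination (T * v * x) unit (m-lem q₁ q₂ T k h x v))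
  lem : ∀ p₀ p₁ p₂ q₀ q₁ q₂ T k h x v y →
    (k * (2ℚ * q₂ * x + q₁) * v * (k * (2ℚ * q₂ * x + q₁) * v)
       - k * k * (q₁ * q₁ - 4ℚ * q₀ * q₂) * (v * v)) * (T * T * T * (q₂ * (h * h)) * y)
      - (T * p₀ * (T * v * (T * v)) + T * p₁ * (T * v * (T * v * x))
          + T * p₂ * (T * v * x * (T * v * x)))
      ≡ T * T * T * (v * v) * (y * (q₀ + q₁ * x + q₂ * (x * x))) * (2ℚ * q₂ * k * h + 1ℚ)
          * (2ℚ * q₂ * k * h - 1ℚ)
        + T * T * T * (v * v) * (y * (q₀ + q₁ * x + q₂ * (x * x)) - (p₀ + p₁ * x + p₂ * (x * x)))
  lem = solve-∀ ringℚ

-- Every value y satisfies that w G y is an integer, where the constant G does not depend on y and w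
-- = u² - e v² is a norm not divisible by p². So p G y is p-integral for all values at once.
irreducible-denominator⇒¬virtualBase : ∀ {X : Pred ℚ 0ℓ} p₀ p₁ p₂ q₀ q₁ q₂ → q₂ ≢ 0ℚ →
  (∀ x → quad q₀ q₁ q₂ x ≢ 0ℚ) →
  (∀ y → y ∈ X → ∃[ x ] y * quad q₀ q₁ q₂ x ≡ quad p₀ p₁ p₂ x) → ¬ IsVirtualBase X
irreducible-denominator⇒¬virtualBase {X} p₀ p₁ p₂ q₀ q₁ q₂ q₂≢0 no-root param =
  conclude (common-denominator (p₀ ∷ p₁ ∷ p₂ ∷ h ∷ μ ∷ []))
  where
  D : ℚ
  D = q₁ * q₁ - 4ℚ * q₀ * q₂
  2q₂≢0 : 2ℚ * q₂ ≢ 0ℚ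
  2q₂≢0 = x*y≢0 {2ℚ} {q₂} (λ ()) q₂≢0
  nonsquare : ∀ y → y * y ≢ D
  -- The quadratic formula: a square root y of D would give the root (y - q₁) / (2 q₂) of the
  -- denominator.
  nonsquare y y²≡D = no-root ((y - q₁) * j)
    (linear-combination₂ (½ * j) (½ * ((y - q₁) * (y - q₁)) * j - q₀) y²≡D unit (root q₀ q₁ q₂ y j))
    where
    j : ℚ
    j = proj₁ (inverse 2q₂≢0)
    unit : 2ℚ * q₂ * j ≡ 1ℚ
    unit = proj₂ (inverse 2q₂≢0)
    root : ∀ q₀ q₁ q₂ y j →
      q₀ + q₁ * ((y - q₁) * j) + q₂ * ((y - q₁) * j * ((y - q₁) * j)) - 0ℚ
        ≡ ½ * j * (y * y - (q₁ * q₁ - 4ℚ * q₀ * q₂))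
          + (½ * ((y - q₁) * (y - q₁)) * j - q₀) * (2ℚ * q₂ * j - 1ℚ)
    root = solve-∀ ringℚ
  open RescalesToNonSquare (nonSquare⇒rescalesToNonSquare D nonsquare)
  p≢0 : p ≢ 0
  p≢0 = ℕ.≢-nonZero⁻¹ p {{prime⇒nonZero p-prime}}
  -- These are the coefficients in x = h z + μ, the inverse of z = k (2 q₂ x + q₁). Their
  -- denominators are cleared too, which makes m = T v x an integer.
  h μ : ℚ
  h = proj₁ (inverse (x*y≢0 2q₂≢0 k≢0))
  μ = - (q₁ * k * h)
  h-unit : 2ℚ * q₂ * k * h ≡ 1ℚ
  h-unit = proj₂ (inverse (x*y≢0 2q₂≢0 k≢0))
  h≢0 : h ≢ 0ℚ
  h≢0 = unit⇒≢0 {h} {2ℚ * q₂ * k} (trans (*-comm h (2ℚ * q₂ * k)) h-unit)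
  conclude : (∃[ T ] fromℤ T ≢ 0ℚ × All (CommonDenominator T) (p₀ ∷ p₁ ∷ p₂ ∷ h ∷ μ ∷ [])) →
             ¬ IsVirtualBase X
  conclude (T′ , T≢0 , Tp₀ ∷ Tp₁ ∷ Tp₂ ∷ Th ∷ Tμ ∷ []) =
    integral-multiples⇒¬virtualBase p-prime (fromℤ (+ p) * G)
      (x*y≢0 (fromℤ≢0 (p≢0 ∘ ℤ.+-injective)) G≢0) integral
    where
    T G : ℚ
    T = fromℤ T′
    G = T * T * T * (q₂ * (h * h))
    G≢0 : G ≢ 0ℚ
    G≢0 = x*y≢0 (x*y≢0 (x*y≢0 T≢0 T≢0) T≢0) (x*y≢0 q₂≢0 (x*y≢0 h≢0 h≢0))
    integral : ∀ y → y ∈ X → Integral p (fromℤ (+ p) * G * y)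
    integral y y∈X = subst (Integral p) (sym (*-assoc (fromℤ (+ p)) G y))
      (p∥denominator⇒integral p-prime w (G * y) (nonSquare {u} {v} u⊥v)
        (subst IsInteger (sym wGy≡) numerator))
      where
      x z m : ℚ
      x = proj₁ (param y y∈X)
      z = k * (2ℚ * q₂ * x + q₁)
      u v w : ℤ
      u = ↥ z
      v = ↧ z
      w = u ℤ.* u ℤ.- e ℤ.* (v ℤ.* v)
      u⊥v : ℕ.Coprime ℤ.∣ u ∣ ℤ.∣ v ∣
      u⊥v = lowest-terms z
      m = T * h * fromℤ u + T * μ * fromℤ v
      w≡ : fromℤ w ≡ fromℤ u * fromℤ u - fromℤ e * (fromℤ v * fromℤ v)
      w≡ = trans (fromℤ-homo-+ (u ℤ.* u) (ℤ.- (e ℤ.* (v ℤ.* v))))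
             (cong₂ _+_ (fromℤ-homo-* u u)
               (trans (fromℤ-homo-neg (e ℤ.* (v ℤ.* v)))
                 (cong -_ (trans (fromℤ-homo-* e (v ℤ.* v))
                                (cong (fromℤ e *_) (fromℤ-homo-* v v))))))
      wGy≡ : fromℤ w * (G * y)
               ≡ T * p₀ * (T * fromℤ v * (T * fromℤ v)) + T * p₁ * (T * fromℤ v * m)
                   + T * p₂ * (m * m)
      wGy≡ = trans (cong (_* (G * y)) w≡)
               (norm-form-denominator p₀ p₁ p₂ q₀ q₁ q₂ T k h x (fromℤ v) y
                 (sym (x*↧x≡↥x z)) (sym k²D≡e) h-unit (proj₂ (param y y∈X)) refl)
      Tv : IsInteger (T * fromℤ v)
      Tv = isInteger-* (fromℤ-isInteger T′) (fromℤ-isInteger v)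
      m-int : IsInteger m
      m-int = isInteger-+ (isInteger-* Th (fromℤ-isInteger u)) (isInteger-* Tμ (fromℤ-isInteger v))
      numerator : IsInteger (T * p₀ * (T * fromℤ v * (T * fromℤ v)) + T * p₁ * (T * fromℤ v * m)
                               + T * p₂ * (m * m))
      numerator = isInteger-+ (isInteger-+ (isInteger-* Tp₀ (isInteger-* Tv Tv))
                                           (isInteger-* Tp₁ (isInteger-* Tv m-int)))
                              (isInteger-* Tp₂ (isInteger-* m-int m-int))

-- Quotients of quadratic polynomials

-- Values are described by y Q(x) = P(x) with Q(x) ≠ 0, which keeps division and its nonvanishing
-- proofs out of the computations with coefficients.
record ValuesOfQuotient (X : Pred ℚ 0ℓ) (p₀ p₁ p₂ q₀ q₁ q₂ : ℚ) : Set where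
  field
    attained : ∀ x y → quad q₀ q₁ q₂ x ≢ 0ℚ → y * quad q₀ q₁ q₂ x ≡ quad p₀ p₁ p₂ x → y ∈ X
    argument : ∀ y → y ∈ X → ∃[ x ] quad q₀ q₁ q₂ x ≢ 0ℚ × y * quad q₀ q₁ q₂ x ≡ quad p₀ p₁ p₂ x
open ValuesOfQuotient

-- With t = (x − b) / (x − a), which misses only the value 1, the quotient becomes α t + β + γ / t.
finitePoles⇒base : ∀ {X p₀ p₁ p₂ q₀ q₁ q₂} a b → ValuesOfQuotient X p₀ p₁ p₂ q₀ q₁ q₂ →
  q₀ ≡ q₂ * (a * b) → q₁ ≡ - (q₂ * (a + b)) → q₂ ≢ 0ℚ → b - a ≢ 0ℚ →
  quad p₀ p₁ p₂ a ≢ 0ℚ → IsBase X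
finitePoles⇒base {X} {p₀} {p₁} {p₂} {q₂ = q₂} a b X-values refl refl q₂≢0 b-a≢0 Pa≢0 =
  laurent⇒base {X} (κ * quad p₀ p₁ p₂ a) (- (κ * (2ℚ * p₀ + p₁ * (a + b) + 2ℚ * p₂ * (a * b))))
    (κ * quad p₀ p₁ p₂ b)
    (x*y≢0 (unit⇒≢0 {κ} {c} (trans (*-comm κ c) cκ≡1)) Pa≢0) value
  where
  c : ℚ
  c = q₂ * ((b - a) * (b - a))
  c≢0 : c ≢ 0ℚ
  c≢0 = x*y≢0 q₂≢0 (x*y≢0 b-a≢0 b-a≢0)
  κ : ℚ
  κ = proj₁ (inverse c≢0)
  cκ≡1 : c * κ ≡ 1ℚ
  cκ≡1 = proj₂ (inverse c≢0)
  -- With x = (b - a t) / (1 - t), this is (1 - t)² P(x), a quadratic in t with leading coefficient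
  -- P(a) and constant term P(b). As Q(x) = c t / (1 - t)², the quotient is κ N(t) / t.
  N : ℚ → ℚ
  N t = p₀ * ((1ℚ - t) * (1ℚ - t)) + p₁ * ((b - a * t) * (1ℚ - t))
             + p₂ * ((b - a * t) * (b - a * t))
  lem-Q : ∀ q₂ a b t w →
    q₂ * (a * b) + - (q₂ * (a + b)) * ((b - a * t) * w) + q₂ * ((b - a * t) * w * ((b - a * t) * w))
      - q₂ * ((b - a) * (b - a)) * t * (w * w)
      ≡ q₂ * ((b - a) * w * b + (b - a) * t * w * a + a * b * ((1ℚ - t) * w - 1ℚ))
        * ((1ℚ - t) * w - 1ℚ)
  lem-Q = solve-∀ ringℚ
  lem-P : ∀ p₀ p₁ p₂ a b t w →
    w * w * (p₀ * ((1ℚ - t) * (1ℚ - t)) + p₁ * ((b - a * t) * (1ℚ - t))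
             + p₂ * ((b - a * t) * (b - a * t)))
      - (p₀ + p₁ * ((b - a * t) * w) + p₂ * ((b - a * t) * w * ((b - a * t) * w)))
      ≡ (p₀ * ((1ℚ - t) * w + 1ℚ) + p₁ * ((b - a * t) * w)) * ((1ℚ - t) * w - 1ℚ)
  lem-P = solve-∀ ringℚ
  lem-y : ∀ p₀ p₁ p₂ a b κ t u →
    t * (κ * (p₀ + p₁ * a + p₂ * (a * a)) * t
          + - (κ * (2ℚ * p₀ + p₁ * (a + b) + 2ℚ * p₂ * (a * b)))
          + κ * (p₀ + p₁ * b + p₂ * (b * b)) * u)
      - κ * (p₀ * ((1ℚ - t) * (1ℚ - t)) + p₁ * ((b - a * t) * (1ℚ - t))
             + p₂ * ((b - a * t) * (b - a * t)))
      ≡ κ * (p₀ + p₁ * b + p₂ * (b * b)) * (t * u - 1ℚ)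
  lem-y = solve-∀ ringℚ
  lem : ∀ y c t w κ n →
    y * (c * t * (w * w)) - w * w * n
      ≡ c * (w * w) * (t * y - κ * n) + w * w * n * (c * κ - 1ℚ)
  lem = solve-∀ ringℚ
  value : ∀ t u → t * u ≡ 1ℚ → t ≢ 1ℚ →
    κ * quad p₀ p₁ p₂ a * t + - (κ * (2ℚ * p₀ + p₁ * (a + b) + 2ℚ * p₂ * (a * b)))
      + κ * quad p₀ p₁ p₂ b * u ∈ X
  value t u tu≡1 t≢1 = attained X-values x y
    (subst (_≢ 0ℚ) (sym Qx≡) (x*y≢0 (x*y≢0 c≢0 (unit⇒≢0 tu≡1)) (x*y≢0 w≢0′ w≢0′)))
    (trans (cong (y *_) Qx≡)
      (trans (linear-combination₂ (c * (w * w)) (w * w * N t) ty≡ cκ≡1 (lem y c t w κ (N t))) w²N≡))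
    where
    1-t≢0 : 1ℚ - t ≢ 0ℚ
    1-t≢0 1-t≡0 = t≢1 (sym (x-y≡0⇒x≡y 1-t≡0))
    w x y : ℚ
    w = proj₁ (inverse 1-t≢0)
    x = (b - a * t) * w
    y = κ * quad p₀ p₁ p₂ a * t + - (κ * (2ℚ * p₀ + p₁ * (a + b) + 2ℚ * p₂ * (a * b)))
          + κ * quad p₀ p₁ p₂ b * u
    W : (1ℚ - t) * w ≡ 1ℚ
    W = proj₂ (inverse 1-t≢0)
    w≢0′ : w ≢ 0ℚ
    w≢0′ = unit⇒≢0 {w} {1ℚ - t} (trans (*-comm w (1ℚ - t)) W)
    Qx≡ : quad (q₂ * (a * b)) (- (q₂ * (a + b))) q₂ x ≡ c * t * (w * w)
    Qx≡ = linear-combination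
      (q₂ * ((b - a) * w * b + (b - a) * t * w * a + a * b * ((1ℚ - t) * w - 1ℚ))) W
      (lem-Q q₂ a b t w)
    w²N≡ : w * w * N t ≡ quad p₀ p₁ p₂ x
    w²N≡ = linear-combination (p₀ * ((1ℚ - t) * w + 1ℚ) + p₁ * ((b - a * t) * w)) W
      (lem-P p₀ p₁ p₂ a b t w)
    ty≡ : t * y ≡ κ * N t
    ty≡ = linear-combination (κ * quad p₀ p₁ p₂ b) tu≡1 (lem-y p₀ p₁ p₂ a b κ t u)

-- The denominator is q₁ (x - a). Expanding P around a and dividing by q₁ t with t = x - a gives the
-- Laurent form, with α = p₂ / q₁.
poleAndInfinity⇒base : ∀ {X p₀ p₁ p₂ q₀ q₁ q₂} a → ValuesOfQuotient X p₀ p₁ p₂ q₀ q₁ q₂ →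
  q₀ ≡ - (q₁ * a) → q₂ ≡ 0ℚ → q₁ ≢ 0ℚ → p₂ ≢ 0ℚ → IsBase X
poleAndInfinity⇒base {X} {p₀} {p₁} {p₂} {q₁ = q₁} a X-values refl refl q₁≢0 p₂≢0 =
  laurent⇒base {X} (κ * p₂) (κ * (p₁ + 2ℚ * p₂ * a)) (κ * quad p₀ p₁ p₂ a)
    (x*y≢0 (unit⇒≢0 {κ} {q₁} (trans (*-comm κ q₁) q₁κ≡1)) p₂≢0) value
  where
  κ : ℚ
  κ = proj₁ (inverse q₁≢0)
  q₁κ≡1 : q₁ * κ ≡ 1ℚ
  q₁κ≡1 = proj₂ (inverse q₁≢0)
  lem-Q : ∀ q₁ a t → - (q₁ * a) + q₁ * (a + t) + 0ℚ * ((a + t) * (a + t)) ≡ q₁ * t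
  lem-Q = solve-∀ ringℚ
  lem : ∀ p₀ p₁ p₂ q₁ κ a t u →
    (κ * p₂ * t + κ * (p₁ + 2ℚ * p₂ * a) + κ * (p₀ + p₁ * a + p₂ * (a * a)) * u) * (q₁ * t)
      - (p₀ + p₁ * (a + t) + p₂ * ((a + t) * (a + t)))
      ≡ (p₀ + p₁ * (a + t) + p₂ * ((a + t) * (a + t))) * (q₁ * κ - 1ℚ)
        + q₁ * κ * (p₀ + p₁ * a + p₂ * (a * a)) * (t * u - 1ℚ)
  lem = solve-∀ ringℚ
  value : ∀ t u → t * u ≡ 1ℚ → t ≢ 1ℚ →
    κ * p₂ * t + κ * (p₁ + 2ℚ * p₂ * a) + κ * quad p₀ p₁ p₂ a * u ∈ X
  value t u tu≡1 _ = attained X-values (a + t) y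
    (subst (_≢ 0ℚ) (sym (lem-Q q₁ a t)) (x*y≢0 q₁≢0 (unit⇒≢0 tu≡1)))
    (trans (cong (y *_) (lem-Q q₁ a t))
      (linear-combination₂ (quad p₀ p₁ p₂ (a + t)) (q₁ * κ * quad p₀ p₁ p₂ a) q₁κ≡1 tu≡1
        (lem p₀ p₁ p₂ q₁ κ a t u)))
    where
    y : ℚ
    y = κ * p₂ * t + κ * (p₁ + 2ℚ * p₂ * a) + κ * quad p₀ p₁ p₂ a * u

-- With t = 1 / (x − a), the quotient becomes a quadratic polynomial in t ≠ 0.
doublePole⇒virtualBase×¬base : ∀ {X p₀ p₁ p₂ q₀ q₁ q₂} a → ValuesOfQuotient X p₀ p₁ p₂ q₀ q₁ q₂ →
  q₀ ≡ q₂ * (a * a) → q₁ ≡ - (q₂ * (a + a)) → q₂ ≢ 0ℚ → quad p₀ p₁ p₂ a ≢ 0ℚ →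
  IsVirtualBase X × ¬ IsBase X
doublePole⇒virtualBase×¬base {X} {p₀} {p₁} {p₂} {q₂ = q₂} a X-values refl refl q₂≢0 Pa≢0 =
  quadratic⇒virtualBase {X} A B C A≢0 value , quadratic⇒¬base {X} A B C A≢0 parameter
  where
  κ A B C : ℚ
  κ = proj₁ (inverse q₂≢0)
  -- The Taylor coefficients of P at a, divided by q₂; the order is reversed because t is the
  -- reciprocal of x - a.
  A = κ * quad p₀ p₁ p₂ a
  B = κ * (p₁ + 2ℚ * p₂ * a)
  C = κ * p₂
  q₂κ≡1 : q₂ * κ ≡ 1ℚ
  q₂κ≡1 = proj₂ (inverse q₂≢0)
  A≢0 : A ≢ 0ℚ
  A≢0 = x*y≢0 (unit⇒≢0 {κ} {q₂} (trans (*-comm κ q₂) q₂κ≡1)) Pa≢0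
  lem-Q : ∀ q₂ a s →
    q₂ * (a * a) + - (q₂ * (a + a)) * (a + s) + q₂ * ((a + s) * (a + s)) ≡ q₂ * (s * s)
  lem-Q = solve-∀ ringℚ
  lem : ∀ p₀ p₁ p₂ q₂ κ a s t →
    (κ * (p₀ + p₁ * a + p₂ * (a * a)) * (t * t) + κ * (p₁ + 2ℚ * p₂ * a) * t + κ * p₂)
        * (q₂ * (s * s))
      - (p₀ + p₁ * (a + s) + p₂ * ((a + s) * (a + s)))
      ≡ (p₀ + p₁ * (a + s) + p₂ * ((a + s) * (a + s))) * (q₂ * κ - 1ℚ)
        + q₂ * κ * ((p₀ + p₁ * a + p₂ * (a * a)) * (s * t + 1ℚ) + (p₁ + 2ℚ * p₂ * a) * s)
            * (s * t - 1ℚ)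
  lem = solve-∀ ringℚ
  quotient-in-t : ∀ s t → s * t ≡ 1ℚ →
    (A * (t * t) + B * t + C) * (q₂ * (s * s)) ≡ quad p₀ p₁ p₂ (a + s)
  quotient-in-t s t st≡1 = linear-combination₂ (quad p₀ p₁ p₂ (a + s))
    (q₂ * κ * (quad p₀ p₁ p₂ a * (s * t + 1ℚ) + (p₁ + 2ℚ * p₂ * a) * s)) q₂κ≡1 st≡1
    (lem p₀ p₁ p₂ q₂ κ a s t)
  value : ∀ t → t ≢ 0ℚ → A * (t * t) + B * t + C ∈ X
  value t t≢0 =
    let s , ts≡1 = inverse t≢0
        st≡1 = trans (*-comm s t) ts≡1
        s≢0 = unit⇒≢0 {s} {t} st≡1
    in  attained X-values (a + s) (A * (t * t) + B * t + C)
          (subst (_≢ 0ℚ) (sym (lem-Q q₂ a s)) (x*y≢0 q₂≢0 (x*y≢0 s≢0 s≢0)))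
          (trans (cong ((A * (t * t) + B * t + C) *_) (lem-Q q₂ a s)) (quotient-in-t s t st≡1))
  undo : ∀ a x → a + (x - a) ≡ x
  undo = solve-∀ ringℚ
  parameter : ∀ y → y ∈ X → ∃[ t ] y ≡ A * (t * t) + B * t + C
  parameter y y∈X = go (argument X-values y y∈X)
    where
    Q : ℚ → ℚ
    Q = quad (q₂ * (a * a)) (- (q₂ * (a + a))) q₂
    go : (∃[ x ] Q x ≢ 0ℚ × y * Q x ≡ quad p₀ p₁ p₂ x) → ∃[ t ] y ≡ A * (t * t) + B * t + C
    go (x , Qx≢0 , yQx≡Px) = t , *-cancelʳ (trans yQ≡P (sym (quotient-in-t s t st≡1)))
      where
      s : ℚ
      s = x - a
      Qx≡ : Q x ≡ q₂ * (s * s)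
      Qx≡ = trans (cong Q (sym (undo a x))) (lem-Q q₂ a s)
      q₂s²≢0 : q₂ * (s * s) ≢ 0ℚ
      q₂s²≢0 = subst (_≢ 0ℚ) Qx≡ Qx≢0
      s≢0 : s ≢ 0ℚ
      s≢0 s≡0 = q₂s²≢0 (trans (cong (λ s → q₂ * (s * s)) s≡0) (*-zeroʳ q₂))
      t : ℚ
      t = proj₁ (inverse s≢0)
      st≡1 : s * t ≡ 1ℚ
      st≡1 = proj₂ (inverse s≢0)
      yQ≡P : y * (q₂ * (s * s)) ≡ quad p₀ p₁ p₂ (a + s)
      yQ≡P = trans (cong (y *_) (sym Qx≡)) (trans yQx≡Px (cong (quad p₀ p₁ p₂) (sym (undo a x))))
      *-cancelʳ : ∀ {z} → y * (q₂ * (s * s)) ≡ z * (q₂ * (s * s)) → y ≡ z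
      *-cancelʳ {z} = *-cancelʳ-≢0 q₂s²≢0

-- The denominator is the constant q₀, so the quotient is a quadratic polynomial in x itself.
doublePoleAtInfinity⇒virtualBase×¬base : ∀ {X p₀ p₁ p₂ q₀ q₁ q₂} →
  ValuesOfQuotient X p₀ p₁ p₂ q₀ q₁ q₂ → q₁ ≡ 0ℚ → q₂ ≡ 0ℚ → q₀ ≢ 0ℚ → p₂ ≢ 0ℚ →
  IsVirtualBase X × ¬ IsBase X
doublePoleAtInfinity⇒virtualBase×¬base {X} {p₀} {p₁} {p₂} {q₀} X-values refl refl q₀≢0 p₂≢0 =
  quadratic⇒virtualBase {X} A B C A≢0 value , quadratic⇒¬base {X} A B C A≢0 parameter
  where
  κ A B C : ℚ
  κ = proj₁ (inverse q₀≢0)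
  A = κ * p₂
  B = κ * p₁
  C = κ * p₀
  q₀κ≡1 : q₀ * κ ≡ 1ℚ
  q₀κ≡1 = proj₂ (inverse q₀≢0)
  A≢0 : A ≢ 0ℚ
  A≢0 = x*y≢0 (unit⇒≢0 {κ} {q₀} (trans (*-comm κ q₀) q₀κ≡1)) p₂≢0
  lem-Q : ∀ q₀ x → q₀ + 0ℚ * x + 0ℚ * (x * x) ≡ q₀
  lem-Q = solve-∀ ringℚ
  lem : ∀ p₀ p₁ p₂ q₀ κ x →
    (κ * p₂ * (x * x) + κ * p₁ * x + κ * p₀) * q₀ - (p₀ + p₁ * x + p₂ * (x * x))
          ≡ (p₀ + p₁ * x + p₂ * (x * x)) * (q₀ * κ - 1ℚ)
  lem = solve-∀ ringℚ
  quotient-in-x : ∀ x → (A * (x * x) + B * x + C) * q₀ ≡ quad p₀ p₁ p₂ x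
  quotient-in-x x = linear-combination (quad p₀ p₁ p₂ x) q₀κ≡1 (lem p₀ p₁ p₂ q₀ κ x)
  value : ∀ x → x ≢ 0ℚ → A * (x * x) + B * x + C ∈ X
  value x _ = attained X-values x (A * (x * x) + B * x + C) (subst (_≢ 0ℚ) (sym (lem-Q q₀ x)) q₀≢0)
    (trans (cong ((A * (x * x) + B * x + C) *_) (lem-Q q₀ x)) (quotient-in-x x))
  parameter : ∀ y → y ∈ X → ∃[ t ] y ≡ A * (t * t) + B * t + C
  parameter y y∈X =
    let x , _ , yQx≡Px = argument X-values y y∈X
    in  x , *-cancelʳ-≢0 q₀≢0 (trans (cong (y *_) (sym (lem-Q q₀ x)))
                                     (trans yQx≡Px (sym (quotient-in-x x))))

-- Polynomials of degree at most two

allZero⇒coeff≡0 : ∀ {p} → All (_≡ 0ℚ) p → ∀ n → coeff p n ≡ 0ℚ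
allZero⇒coeff≡0 []        n       = refl
allZero⇒coeff≡0 (c≡0 ∷ _) zero    = c≡0
allZero⇒coeff≡0 (_ ∷ z)   (suc n) = allZero⇒coeff≡0 z n

degree<⇒coeff≡0 : ∀ p {n} → degree p ℕ.< n → coeff p n ≡ 0ℚ
degree<⇒coeff≡0 []      _ = refl
degree<⇒coeff≡0 (c ∷ p) {suc n} deg<n with all? (_≟ 0ℚ) p
... | yes z = allZero⇒coeff≡0 z n
... | no  _ = degree<⇒coeff≡0 p (ℕ.s<s⁻¹ deg<n)

leading≢0 : ∀ p → ¬ All (_≡ 0ℚ) p → coeff p (degree p) ≢ 0ℚ
leading≢0 []      ¬z = contradiction [] ¬z
leading≢0 (c ∷ p) ¬z with all? (_≟ 0ℚ) p
... | yes z  = λ c≡0 → ¬z (c≡0 ∷ z)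
... | no  ¬z′ = leading≢0 p ¬z′

-- A positive degree forces a tail that is not all zeros, to which `leading≢0` applies.
degree≡suc⇒coeff≢0 : ∀ p {n} → degree p ≡ suc n → coeff p (suc n) ≢ 0ℚ
degree≡suc⇒coeff≢0 (c ∷ p) deg≡ with all? (_≟ 0ℚ) p
degree≡suc⇒coeff≢0 (c ∷ p) refl | no ¬z = leading≢0 p ¬z

coeff≡0⇒eval≡0 : ∀ p a → (∀ n → coeff p n ≡ 0ℚ) → eval p a ≡ 0ℚ
coeff≡0⇒eval≡0 []      a _ = refl
coeff≡0⇒eval≡0 (c ∷ p) a z =
  trans (cong₂ (λ c v → c + a * v) (z 0) (coeff≡0⇒eval≡0 p a (z ∘ suc)))
        (trans (+-identityˡ (a * 0ℚ)) (*-zeroʳ a))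

quadP : Poly → ℚ → ℚ
quadP p = quad (coeff p 0) (coeff p 1) (coeff p 2)

-- The list may be longer than three entries, but all further entries are zeros and evaluate to 0.
eval≡quad : ∀ p → degree p ℕ.≤ 2 → ∀ a → eval p a ≡ quadP p a
eval≡quad p deg≤2 a = go p (λ n → degree<⇒coeff≡0 p (ℕ.s≤s (ℕ.≤-trans deg≤2 (ℕ.m≤m+n 2 n))))
  where
  lem₀ : ∀ a → 0ℚ ≡ 0ℚ + 0ℚ * a + 0ℚ * (a * a)
  lem₀ = solve-∀ ringℚ
  lem₁ : ∀ c a → c + a * 0ℚ ≡ c + 0ℚ * a + 0ℚ * (a * a)
  lem₁ = solve-∀ ringℚ
  lem₂ : ∀ c d a → c + a * (d + a * 0ℚ) ≡ c + d * a + 0ℚ * (a * a)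
  lem₂ = solve-∀ ringℚ
  lem₃ : ∀ c d e a → c + a * (d + a * (e + a * 0ℚ)) ≡ c + d * a + e * (a * a)
  lem₃ = solve-∀ ringℚ
  go : ∀ p → (∀ n → coeff p (3 ℕ.+ n) ≡ 0ℚ) → eval p a ≡ quadP p a
  go []              _ = lem₀ a
  go (c ∷ [])        _ = lem₁ c a
  go (c ∷ d ∷ [])    _ = lem₂ c d a
  go (c ∷ d ∷ e ∷ p) z =
    trans (cong (λ v → c + a * (d + a * (e + a * v))) (coeff≡0⇒eval≡0 p a z)) (lem₃ c d e a)

root⇒linear-divisor : ∀ p → degree p ℕ.≤ 2 → ∀ a → quadP p a ≡ 0ℚ → (- a ∷ 1ℚ ∷ []) ∣ p
root⇒linear-divisor p deg≤2 a root =
  -- Synthetic division by x - a; the remainder is the value at a.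
  (coeff p 1 + coeff p 2 * a ∷ coeff p 2 ∷ []) , coefficients
  where
  lem₀ : ∀ p₀ p₁ p₂ a → p₀ - (- a * (p₁ + p₂ * a) + 0ℚ) ≡ 1ℚ * (p₀ + p₁ * a + p₂ * (a * a) - 0ℚ)
  lem₀ = solve-∀ ringℚ
  lem₁ : ∀ p₁ p₂ a → p₁ ≡ - a * p₂ + (1ℚ * (p₁ + p₂ * a) + 0ℚ)
  lem₁ = solve-∀ ringℚ
  coefficients : p ≈ (- a ∷ 1ℚ ∷ []) ⊗ (coeff p 1 + coeff p 2 * a ∷ coeff p 2 ∷ [])
  coefficients 0 = linear-combination 1ℚ root (lem₀ (coeff p 0) (coeff p 1) (coeff p 2) a)
  coefficients 1 = lem₁ (coeff p 1) (coeff p 2) a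
  coefficients 2 = sym (*-identityˡ (coeff p 2))
  coefficients (suc (suc (suc n))) = degree<⇒coeff≡0 p (ℕ.s≤s (ℕ.≤-trans deg≤2 (ℕ.m≤m+n 2 n)))

-- Poles of a rational function of degree two

module DegreeTwo (f : RationalFunction) (deg≡2 : degreeᴿ f ≡ 2) where
  p₀ p₁ p₂ q₀ q₁ q₂ : ℚ
  p₀ = coeff (num f) 0
  p₁ = coeff (num f) 1
  p₂ = coeff (num f) 2
  q₀ = coeff (den f) 0
  q₁ = coeff (den f) 1
  q₂ = coeff (den f) 2
  P Q : ℚ → ℚ
  P = quad p₀ p₁ p₂
  Q = quad q₀ q₁ q₂

  num≤2 : degree (num f) ℕ.≤ 2
  num≤2 = ℕ.≤-trans (ℕ.m≤m⊔n (degree (num f)) (degree (den f))) (ℕ.≤-reflexive deg≡2)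

  den≤2 : degree (den f) ℕ.≤ 2
  den≤2 = ℕ.≤-trans (ℕ.m≤n⊔m (degree (num f)) (degree (den f))) (ℕ.≤-reflexive deg≡2)

  eval-den : ∀ a → eval (den f) a ≡ Q a
  eval-den = eval≡quad (den f) den≤2

  eval-num : ∀ a → eval (num f) a ≡ P a
  eval-num = eval≡quad (num f) num≤2

  pole⇒root : ∀ a → IsPole f (fin a) → Q a ≡ 0ℚ
  pole⇒root a = trans (sym (eval-den a))

  root⇒pole : ∀ a → Q a ≡ 0ℚ → IsPole f (fin a)
  root⇒pole a = trans (eval-den a)

  pole∞⇒num≡2 : IsPole f ∞ → degree (num f) ≡ 2
  pole∞⇒num≡2 den<num = trans (sym (ℕ.m≥n⇒m⊔n≡m (ℕ.<⇒≤ den<num))) deg≡2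

  pole∞⇒p₂≢0 : IsPole f ∞ → p₂ ≢ 0ℚ
  pole∞⇒p₂≢0 den<num = degree≡suc⇒coeff≢0 (num f) (pole∞⇒num≡2 den<num)

  pole∞⇒q₂≡0 : IsPole f ∞ → q₂ ≡ 0ℚ
  pole∞⇒q₂≡0 den<num =
    degree<⇒coeff≡0 (den f) (subst (degree (den f) ℕ.<_) (pole∞⇒num≡2 den<num) den<num)

  -- Unless the numerator has the larger degree, the denominator attains the maximum 2, and q₂ is
  -- its leading coefficient.
  q₂≡0⇒pole∞ : q₂ ≡ 0ℚ → IsPole f ∞
  q₂≡0⇒pole∞ q₂≡0 with ℕ.<-cmp (degree (den f)) (degree (num f))
  ... | tri< den<num _ _ = den<num
  ... | tri≈ _ den≡num _ = contradiction q₂≡0 (degree≡suc⇒coeff≢0 (den f)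
          (trans (sym (ℕ.m≤n⇒m⊔n≡n (ℕ.≤-reflexive (sym den≡num)))) deg≡2))
  ... | tri> _ _ num<den = contradiction q₂≡0 (degree≡suc⇒coeff≢0 (den f)
          (trans (sym (ℕ.m≤n⇒m⊔n≡n (ℕ.<⇒≤ num<den))) deg≡2))

  den-nonzero : q₀ ≡ 0ℚ → q₁ ≡ 0ℚ → q₂ ≢ 0ℚ
  den-nonzero q₀≡0 q₁≡0 q₂≡0 = den≉0 f den≈0
    where
    den≈0 : den f ≈ []
    den≈0 0 = q₀≡0
    den≈0 1 = q₁≡0
    den≈0 2 = q₂≡0
    den≈0 (suc (suc (suc n))) =
      degree<⇒coeff≡0 (den f) (ℕ.s≤s (ℕ.≤-trans den≤2 (ℕ.m≤m+n 2 n)))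

  -- A common root would make x - a a common factor of degree 1, against lowest terms.
  root⇒P≢0 : ∀ a → Q a ≡ 0ℚ → P a ≢ 0ℚ
  root⇒P≢0 a Qa≡0 Pa≡0 = contradiction
    (lowestTerms f (- a ∷ 1ℚ ∷ []) (root⇒linear-divisor (num f) num≤2 a Pa≡0)
                                   (root⇒linear-divisor (den f) den≤2 a Qa≡0))
    λ ()

  values : ValuesOfQuotient (ValueSet f) p₀ p₁ p₂ q₀ q₁ q₂
  values = record { attained = value-attained ; argument = value-argument }
    where
    valueAt-* : ∀ x ¬pole → valueAt f x ¬pole * eval (den f) x ≡ eval (num f) x
    valueAt-* x ¬pole = trans (*-assoc (eval (num f) x) _ (eval (den f) x))
      (trans (cong (eval (num f) x *_) (*-inverseˡ (eval (den f) x) {{≢-nonZero ¬pole}}))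
             (*-identityʳ (eval (num f) x)))
    value-attained : ∀ x y → Q x ≢ 0ℚ → y * Q x ≡ P x → y ∈ ValueSet f
    value-attained x y Qx≢0 yQx≡Px = x , ¬pole , *-cancelʳ-≢0 ¬pole
      (trans (cong (y *_) (eval-den x))
        (trans yQx≡Px (trans (sym (eval-num x)) (sym (valueAt-* x ¬pole)))))
      where
      ¬pole : ¬ IsPole f (fin x)
      ¬pole = Qx≢0 ∘ pole⇒root x
    value-argument : ∀ y → y ∈ ValueSet f → ∃[ x ] Q x ≢ 0ℚ × y * Q x ≡ P x
    value-argument y (x , ¬pole , refl) = x , ¬pole ∘ root⇒pole x ,
      trans (cong (y *_) (sym (eval-den x))) (trans (valueAt-* x ¬pole) (eval-num x))

  -- Vieta: b Q(a) - a Q(b) and Q(b) - Q(a) both contain the factor b - a, and cancelling it leaves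
  -- the two formulas.
  distinct-roots : ∀ a b → b - a ≢ 0ℚ → Q a ≡ 0ℚ → Q b ≡ 0ℚ →
                   q₀ ≡ q₂ * (a * b) × q₁ ≡ - (q₂ * (a + b))
  distinct-roots a b b-a≢0 Qa≡0 Qb≡0 =
    *-cancelʳ-≢0 b-a≢0 (linear-combination₂ b (- a) Qa≡0 Qb≡0 (lem₀ q₀ q₁ q₂ a b)) ,
    *-cancelʳ-≢0 b-a≢0 (linear-combination₂ (- 1ℚ) 1ℚ Qa≡0 Qb≡0 (lem₁ q₀ q₁ q₂ a b))
    where
    lem₀ : ∀ q₀ q₁ q₂ a b → q₀ * (b - a) - q₂ * (a * b) * (b - a)
      ≡ b * (q₀ + q₁ * a + q₂ * (a * a) - 0ℚ) + - a * (q₀ + q₁ * b + q₂ * (b * b) - 0ℚ)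
    lem₀ = solve-∀ ringℚ
    lem₁ : ∀ q₀ q₁ q₂ a b → q₁ * (b - a) - - (q₂ * (a + b)) * (b - a)
      ≡ - 1ℚ * (q₀ + q₁ * a + q₂ * (a * a) - 0ℚ) + 1ℚ * (q₀ + q₁ * b + q₂ * (b * b) - 0ℚ)
    lem₁ = solve-∀ ringℚ

  pole-and-∞⇒WP : ∀ a → IsPole f (fin a) → IsPole f ∞ → WP f
  pole-and-∞⇒WP a pole-a pole-∞ =
    poleAndInfinity⇒base a values q₀≡ q₂≡0 q₁≢0 (pole∞⇒p₂≢0 pole-∞)
    where
    q₂≡0 : q₂ ≡ 0ℚ
    q₂≡0 = pole∞⇒q₂≡0 pole-∞
    lem : ∀ q₀ q₁ q₂ a → q₀ - - (q₁ * a)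
            ≡ 1ℚ * (q₀ + q₁ * a + q₂ * (a * a) - 0ℚ) + - (a * a) * (q₂ - 0ℚ)
    lem = solve-∀ ringℚ
    q₀≡ : q₀ ≡ - (q₁ * a)
    q₀≡ = linear-combination₂ 1ℚ (- (a * a)) (pole⇒root a pole-a) q₂≡0 (lem q₀ q₁ q₂ a)
    q₁≢0 : q₁ ≢ 0ℚ
    -- Otherwise q₀ = -q₁ a would vanish too, and with it the whole denominator.
    q₁≢0 q₁≡0 = den-nonzero (trans q₀≡ (cong -_ (trans (cong (_* a) q₁≡0) (*-zeroˡ a)))) q₁≡0 q₂≡0

  two-poles⇒WP : (∃₂ λ P Q → P ≢ Q × IsPole f P × IsPole f Q) → WP f
  two-poles⇒WP (fin a , fin b , a≢b , pole-a , pole-b) =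
    finitePoles⇒base a b values q₀≡ q₁≡ q₂≢0 b-a≢0 (root⇒P≢0 a (pole⇒root a pole-a))
    where
    b-a≢0 : b - a ≢ 0ℚ
    b-a≢0 b-a≡0 = a≢b (cong fin (sym (x-y≡0⇒x≡y b-a≡0)))
    q₀≡ : q₀ ≡ q₂ * (a * b)
    q₀≡ = proj₁ (distinct-roots a b b-a≢0 (pole⇒root a pole-a) (pole⇒root b pole-b))
    q₁≡ : q₁ ≡ - (q₂ * (a + b))
    q₁≡ = proj₂ (distinct-roots a b b-a≢0 (pole⇒root a pole-a) (pole⇒root b pole-b))
    q₂≢0 : q₂ ≢ 0ℚ
    q₂≢0 q₂≡0 = den-nonzero (trans q₀≡ (trans (cong (_* (a * b)) q₂≡0) (*-zeroˡ (a * b))))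
                            (trans q₁≡ (cong -_ (trans (cong (_* (a + b)) q₂≡0) (*-zeroˡ (a + b)))))
                            q₂≡0
  two-poles⇒WP (fin a , ∞ , _ , pole-a , pole-∞) = pole-and-∞⇒WP a pole-a pole-∞
  two-poles⇒WP (∞ , fin a , _ , pole-∞ , pole-a) = pole-and-∞⇒WP a pole-a pole-∞
  two-poles⇒WP (∞ , ∞ , ∞≢∞ , _) = contradiction refl ∞≢∞

  -- Uniqueness forces the pole to be double: the denominator is constant if the pole is ∞, and q₂
  -- (x - a)² if it is a, since anything else would supply a second pole.
  one-pole⇒EWP×¬WP : ∃! _≡_ (IsPole f) → EWP f × ¬ WP f
  one-pole⇒EWP×¬WP (∞ , pole-∞ , unique) =
    doublePoleAtInfinity⇒virtualBase×¬base values q₁≡0 q₂≡0 q₀≢0 (pole∞⇒p₂≢0 pole-∞)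
    where
    q₂≡0 : q₂ ≡ 0ℚ
    q₂≡0 = pole∞⇒q₂≡0 pole-∞
    lem : ∀ q₀ q₁ q₂ j → q₀ + q₁ * - (q₀ * j) + q₂ * (- (q₀ * j) * - (q₀ * j)) - 0ℚ
            ≡ - q₀ * (q₁ * j - 1ℚ) + q₀ * j * (q₀ * j) * (q₂ - 0ℚ)
    lem = solve-∀ ringℚ
    q₁≡0 : q₁ ≡ 0ℚ
    q₁≡0 with q₁ ≟ 0ℚ
    ... | yes q₁≡0 = q₁≡0
    -- A linear denominator would have the further root -q₀ / q₁.
    ... | no  q₁≢0 = contradiction
      (unique {fin (- (q₀ * j))} (root⇒pole (- (q₀ * j)) another-root)) λ ()
      where
      j : ℚ
      j = proj₁ (inverse q₁≢0)
      another-root : Q (- (q₀ * j)) ≡ 0ℚ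
      another-root = linear-combination₂ (- q₀) (q₀ * j * (q₀ * j)) (proj₂ (inverse q₁≢0)) q₂≡0
                       (lem q₀ q₁ q₂ j)
    q₀≢0 : q₀ ≢ 0ℚ
    q₀≢0 q₀≡0 = den-nonzero q₀≡0 q₁≡0 q₂≡0
  one-pole⇒EWP×¬WP (fin a , pole-a , unique) =
    doublePole⇒virtualBase×¬base a values q₀≡ q₁≡ q₂≢0 (root⇒P≢0 a (pole⇒root a pole-a))
    where
    q₂≢0 : q₂ ≢ 0ℚ
    q₂≢0 q₂≡0 = contradiction (unique (q₂≡0⇒pole∞ q₂≡0)) λ ()
    j b : ℚ
    j = proj₁ (inverse q₂≢0)
    b = - (q₁ * j) - a
    q₂j≡1 : q₂ * j ≡ 1ℚ
    q₂j≡1 = proj₂ (inverse q₂≢0)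
    -- b is the second root of the denominator, by Vieta.
    lem-b : ∀ q₀ q₁ q₂ a j →
      q₀ + q₁ * (- (q₁ * j) - a) + q₂ * ((- (q₁ * j) - a) * (- (q₁ * j) - a)) - 0ℚ
        ≡ 1ℚ * (q₀ + q₁ * a + q₂ * (a * a) - 0ℚ) + (q₁ * q₁ * j + 2ℚ * q₁ * a) * (q₂ * j - 1ℚ)
    lem-b = solve-∀ ringℚ
    a≡b : a ≡ b
    a≡b = fin-injective (unique (root⇒pole b (linear-combination₂ 1ℚ (q₁ * q₁ * j + 2ℚ * q₁ * a)
            (pole⇒root a pole-a) q₂j≡1 (lem-b q₀ q₁ q₂ a j))))
      where
      fin-injective : ∀ {x y} → fin x ≡ fin y → x ≡ y
      fin-injective refl = refl
    lem₁ : ∀ q₁ q₂ a j → q₁ - - (q₂ * (a + a)) ≡ q₂ * (a - (- (q₁ * j) - a)) + - q₁ * (q₂ * j - 1ℚ)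
    lem₁ = solve-∀ ringℚ
    q₁≡ : q₁ ≡ - (q₂ * (a + a))
    q₁≡ = linear-combination₂ q₂ (- q₁) a≡b q₂j≡1 (lem₁ q₁ q₂ a j)
    lem₀ : ∀ q₀ q₁ q₂ a → q₀ - q₂ * (a * a)
             ≡ 1ℚ * (q₀ + q₁ * a + q₂ * (a * a) - 0ℚ) + - a * (q₁ - - (q₂ * (a + a)))
    lem₀ = solve-∀ ringℚ
    q₀≡ : q₀ ≡ q₂ * (a * a)
    q₀≡ = linear-combination₂ 1ℚ (- a) (pole⇒root a pole-a) q₁≡ (lem₀ q₀ q₁ q₂ a)

  -- Without a pole at ∞ the denominator has degree exactly 2, and without finite poles it is
  -- irreducible over ℚ.
  no-pole⇒¬EWP : ¬ ∃ (IsPole f) → ¬ EWP f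
  no-pole⇒¬EWP no-pole = irreducible-denominator⇒¬virtualBase p₀ p₁ p₂ q₀ q₁ q₂
    (λ q₂≡0 → no-pole (∞ , q₂≡0⇒pole∞ q₂≡0))
    (λ a Qa≡0 → no-pole (fin a , root⇒pole a Qa≡0))
    (λ y y∈X → let x , _ , yQx≡Px = argument values y y∈X in x , yQx≡Px)

theorem4p3 : (f : RationalFunction) → degreeᴿ f ≡ 2 →
    ((∃₂ λ P Q → P ≢ Q × IsPole f P × IsPole f Q) → WP f)
    × (∃! _≡_ (IsPole f) → EWP f × ¬ WP f)
    × (¬ ∃ (IsPole f) → ¬ EWP f)
theorem4p3 f deg≡2 = two-poles⇒WP , one-pole⇒EWP×¬WP , no-pole⇒¬EWP
  where open DegreeTwo f deg≡2
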